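{- Let $r$ be a positive integer and let $P$ be an $r$-element poset of height at most $2$. Then $\Lambda^*(P) \le 4r + \sqrt{(32 \ln 2)r} + 6$.
   Context: For a positive integer $n$, $[n]=\{1,\dots,n\}$ and $\mathcal{B}_n$ denotes the family of all subsets of $[n]$ ordered by inclusion. A poset $P$ is a subposet of $Q$ if $P\subseteq Q$ and $x\le_P y$ iff $x\le_Q y$; a family $\mathcal{F}\subseteq\mathcal{B}_n$ (ordered by inclusion) contains a copy of $P$ if some subposet of $(\mathcal{F},\subseteq)$ is isomorphic to $P$, and $\mathcal{F}$ is $P$-free otherwise. The height of a poset is the maximum size of a chain. The Lubell function of $\mathcal{F}\subseteq\mathcal{B}_n$ is $\ell(\mathcal{F})=\sum_{A\in\mathcal{F}}1/\binom{n}{|A|}$ (the expected number of sets of $\mathcal{F}$ on a uniformly random maximal chain of $\mathcal{B}_n$). The strong Lubell threshold is $\Lambda^*(P)=\sup\{\ell(\mathcal{F}) : n\ge 1,\ \mathcal{F}\subseteq\mathcal{B}_n,\ \mathcal{F}\text{ is }P\text{ -free}\}$. -}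

module Defs where

open import Data.Nat as ℕ using (ℕ; zero; suc)
open import Data.Nat.Combinatorics using (_C_)
open import Data.Integer using (+_)
open import Data.Rational as ℚ using (ℚ; 0ℚ; _/_)
open import Data.Fin using (Fin)
open import Data.Fin.Subset using (Subset; _⊆_; ∣_∣)
open import Data.List using (List; []; _∷_; foldr; map)
open import Data.List.Membership.Propositional using (_∈_)
open import Data.Product using (Σ; _×_; _,_)
open import Data.Sum using (_⊎_)
open import Data.Empty using (⊥)
open import Relation.Binary.PropositionalEquality using (_≡_; _≢_)
open import Function.Bundles using (_⇔_)

HeightAtMost2 : {r : ℕ} → (Fin r → Fin r → Set) → Set
HeightAtMost2 {r} _≤P_ =
  (a b c : Fin r) → a ≤P b → b ≤P c → a ≢ b → b ≢ c → ⊥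

ContainsCopy : {r : ℕ} → (Fin r → Fin r → Set) → (n : ℕ) → List (Subset n) → Set
ContainsCopy {r} _≤P_ n F =
  Σ (Fin r → Subset n) λ f →
    ((i : Fin r) → f i ∈ F)
    × ((i j : Fin r) → f i ≡ f j → i ≡ j)
    × ((i j : Fin r) → (i ≤P j) ⇔ (f i ⊆ f j))

-- 1/m as a rational (with 1/0 := 0; only used for m = n C k ≥ 1).
inv : ℕ → ℚ
inv zero    = 0ℚ
inv (suc m) = + 1 / suc m

sumℚ : List ℚ → ℚ
sumℚ = foldr ℚ._+_ 0ℚ

lubell : (n : ℕ) → List (Subset n) → ℚ
lubell n F = sumℚ (map (λ A → inv (n C ∣ A ∣)) F)

-- S N = Σ_{k=1}^{N} 1/(k 2^k)   (partial sums of ln 2 = Σ_{k≥1} 1/(k 2^k))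
lnTwoPartial : ℕ → ℚ
lnTwoPartial zero    = 0ℚ
lnTwoPartial (suc N) = lnTwoPartial N ℚ.+ inv (suc N ℕ.* 2 ℕ.^ suc N)

-- U N = S N + 1/((N+1) 2^N) is an upper bound for ln 2, and U N → ln 2.
-- Hence ln 2 = inf_N U N.
lnTwoUpper : ℕ → ℚ
lnTwoUpper N = lnTwoPartial N ℚ.+ inv (suc N ℕ.* 2 ℕ.^ N)

-- y ≤ c · ln 2   (for rational y and c ≥ 0), i.e. y ≤ c · U N for all N.
≤-mul-ln2 : ℚ → ℚ → Set
≤-mul-ln2 y c = (N : ℕ) → y ℚ.≤ c ℚ.* lnTwoUpper N

-- q ≤ 4r + sqrt((32 ln 2) r) + 6,
-- i.e. with x = q - 4r - 6:  x ≤ 0  or  x² ≤ 32 r ln 2.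
≤Bound : ℕ → ℚ → Set
≤Bound r q =
  let x = q ℚ.- ((+ (4 ℕ.* r ℕ.+ 6)) / 1) in
  (x ℚ.≤ 0ℚ) ⊎ ≤-mul-ln2 (x ℚ.* x) ((+ (32 ℕ.* r)) / 1)

{-# OPTIONS --safe #-}
module Submission where

open import Defs
open import Data.Bool as Bool using (Bool; true; false; if_then_else_; not; _∧_; _∨_)
import Data.Bool.Properties as Bool
open import Data.Empty using (⊥-elim)
open import Data.Fin using (Fin; zero; suc)
import Data.Fin.Properties as Fin
open import Data.Fin.Subset using (Subset; _∪_; ⁅_⁆; _∈_; _∉_; _⊆_; ∣_∣; ⊥)
open import Data.Fin.Subset.Properties using (∪-assoc; ∪-comm; x∈p∪q⁺; x∈p∪q⁻; x∈⁅x⁆; x∈⁅y⁆⇒x≡y; ⊆-antisym; ⊆-refl; ⊆-reflexive; ⊆-trans; ∉⊥; _⊆?_) renaming (_∈?_ to _∈ₛ?_)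
open import Data.Integer as ℤ using (+_)
import Data.Integer.Properties as ℤ
open import Data.List using (List; []; _∷_)
open import Data.List.Membership.DecPropositional using () renaming (_∈?_ to mem?)
open import Data.List.Membership.Propositional using (lose; find) renaming (_∈_ to _∈ₗ_)
open import Data.List.Relation.Unary.All as All using ([]; _∷_)
open import Data.List.Relation.Unary.AllPairs using ([]; _∷_)
open import Data.List.Relation.Unary.Any as Any using (Any; here; there; any?)
open import Data.List.Relation.Unary.Unique.Propositional using (Unique)
open import Data.Nat as ℕ using (ℕ; zero; suc)
open import Data.Nat.Combinatorics using (nC1≡n; nCk≡nC[n∸k]; nCk+nC[k+1]≡[n+1]C[k+1]) renaming (_C_ to _choose_)
import Data.Nat.Properties as ℕ
open import Data.Nat.Solver using () renaming (module +-*-Solver to ℕ-Solver)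
open import Data.Product using (∃; _×_; _,_; proj₁; proj₂)
open import Data.Rational as ℚ using (ℚ; 0ℚ; 1ℚ; ½; _+_; _*_; _-_; -_; _≤_; _/_)
open import Data.Rational.Properties as ℚ using (≤-trans; ≤-refl; ≤-reflexive)
open import Data.Rational.Solver using (module +-*-Solver)
import Data.Rational.Unnormalised as ℚᵘ
import Data.Rational.Unnormalised.Properties as ℚᵘ
open import Data.Sum as Sum using (_⊎_; inj₁; inj₂)
open import Data.Vec as Vec using (Vec; []; _∷_; lookup; allFin)
open import Data.Vec.Membership.Propositional using () renaming (_∈_ to _∈ᵥ_)
open import Data.Vec.Membership.Propositional.Properties using (∈-allFin⁺; ∈-lookup)
import Data.Vec.Properties as Vec
open import Data.Vec.Relation.Unary.All as VAll using ([]; _∷_)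
open import Data.Vec.Relation.Unary.AllPairs using ([]; _∷_)
open import Data.Vec.Relation.Unary.Any using (here; there)
open import Data.Vec.Relation.Unary.Unique.Propositional using () renaming (Unique to Distinct)
open import Data.Vec.Relation.Unary.Unique.Propositional.Properties using (lookup-injective; tabulate⁺)
open import Effect.Monad using (RawMonad)
open import Function.Bundles using (mk⇔)
open import Relation.Binary.Definitions using (Decidable; DecidableEquality)
open import Relation.Binary.PropositionalEquality using (_≡_; _≢_; refl; sym; trans; cong; cong₂; subst; subst₂; module ≡-Reasoning)
open import Relation.Binary.Structures using (IsPartialOrder)
open import Relation.Nullary using (yes; no; ¬_; Dec; does)
open import Relation.Nullary.Decidable using (dec-true; dec-false; decidable-stable; ¬¬-excluded-middle; _×-dec_; _⊎-dec_; ¬?)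
open import Relation.Nullary.Negation using (¬¬-Monad)

open +-*-Solver using (solve; _:+_; _:*_; _:-_; :-_; con; _:=_)
open ℕ-Solver using () renaming (_:+_ to _:+ℕ_; _:*_ to _:*ℕ_; _:=_ to _:=ℕ_; con to con′)

-- Let e(D,R) be the expected number of members of F on a random maximal chain from D to D ∪ R; the
-- Lubell function is e(∅,[n]).  By induction on |R|, e(D,R) ≤ L for a suitable L ≈ 4r + 4√r.
-- Call x bad at D if no member of F inside D ∪ {x} contains x.
-- (1) Run the chain until fewer than a fraction 1/k of the remaining elements are bad.  The expected
--     number of hits before that is at most k: revealing the first element of the chain last shows
--     that from every state there are no more hits with probability at least 1/k.
-- (2) From the stopped state D, draw random elements until 2r good ones, X, are found; each draw costs
--     at most 1 in e, averaged over the two ways to decide whether it belongs to the upper sets.  The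
--     remaining value is an average over I ⊆ X of the values of smaller intervals, each at most L.  If
--     F is P-free, the traces I with a non-zero value shatter no r-subset of X, so by the Sauer-Shelah
--     lemma their density is at most ρ = (1 − C(2r,r)/4^r)/2: a shattered r-set gives a copy of P, the
--     non-maximal elements going to sets A with x ∈ A ⊆ D ∪ {x} and the maximal ones to sets above D.
-- Altogether L = ρL + 2r + 2r/κ + 1 + k with k = κ + 1, and κ between √r and 2√r gives the bound,
-- using only ln 2 ≥ 1/2.

private variable
  A : Set
  n m : ℕ

-- Rational inequalities, the embedding of ℕ in ℚ, and reciprocals

0≤-+ : ∀ {p q} → 0ℚ ≤ p → 0ℚ ≤ q → 0ℚ ≤ p + q
0≤-+ = ℚ.+-mono-≤

0≤-* : ∀ {p q} → 0ℚ ≤ p → 0ℚ ≤ q → 0ℚ ≤ p * q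
0≤-* {p} {q} 0≤p 0≤q =
  subst (_≤ p * q) (ℚ.*-zeroʳ p) (ℚ.*-monoˡ-≤-nonNeg p {{ℚ.nonNegative 0≤p}} 0≤q)

≤⇒0≤- : ∀ {p q} → p ≤ q → 0ℚ ≤ q - p
≤⇒0≤- {p} {q} p≤q = subst (_≤ q - p) (ℚ.+-inverseʳ p) (ℚ.+-monoˡ-≤ (- p) p≤q)

≤-by-difference : ∀ {p q} d → 0ℚ ≤ d → q ≡ p + d → p ≤ q
≤-by-difference {p} d 0≤d refl = subst (_≤ p + d) (ℚ.+-identityʳ p) (ℚ.+-monoʳ-≤ p 0≤d)

*-monoˡ-≤ : ∀ {c p q} → 0ℚ ≤ c → p ≤ q → c * p ≤ c * q
*-monoˡ-≤ {c} 0≤c = ℚ.*-monoˡ-≤-nonNeg c {{ℚ.nonNegative 0≤c}}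

0≤1 : 0ℚ ≤ 1ℚ
0≤1 = ℚ.nonNegative⁻¹ 1ℚ

0≤½ : 0ℚ ≤ ½
0≤½ = ℚ.nonNegative⁻¹ ½

-- Recursive rather than `+ n / 1`, so that `ι (suc n)` unfolds to `1ℚ + ι n` in ring identities;
-- `/1≡ι` links the two forms.
ι : ℕ → ℚ
ι zero    = 0ℚ
ι (suc n) = 1ℚ + ι n

0≤ι : ∀ n → 0ℚ ≤ ι n
0≤ι zero    = ≤-refl
0≤ι (suc n) = 0≤-+ 0≤1 (0≤ι n)

ι-+ : ∀ m n → ι (m ℕ.+ n) ≡ ι m + ι n
ι-+ zero    n = sym (ℚ.+-identityˡ (ι n))
ι-+ (suc m) n = trans (cong (_+_ 1ℚ) (ι-+ m n)) (sym (ℚ.+-assoc 1ℚ (ι m) (ι n)))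

ι-* : ∀ m n → ι (m ℕ.* n) ≡ ι m * ι n
ι-* zero    n = sym (ℚ.*-zeroˡ (ι n))
ι-* (suc m) n = begin
  ι (n ℕ.+ m ℕ.* n)     ≡⟨ ι-+ n (m ℕ.* n) ⟩
  ι n + ι (m ℕ.* n)     ≡⟨ cong (_+_ (ι n)) (ι-* m n) ⟩
  ι n + ι m * ι n       ≡⟨ solve 2 (λ a b → b :+ a :* b := (con 1ℚ :+ a) :* b) refl (ι m) (ι n) ⟩
  (1ℚ + ι m) * ι n      ∎
  where open ≡-Reasoning

ι-mono : ∀ {m n} → m ℕ.≤ n → ι m ≤ ι n
ι-mono {n = n} ℕ.z≤n = 0≤ι n
ι-mono (ℕ.s≤s m≤n)   = ℚ.+-monoʳ-≤ 1ℚ (ι-mono m≤n)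

toℚᵘ-/ : ∀ p n → ℚ.toℚᵘ (p / suc n) ℚᵘ.≃ ℚᵘ.mkℚᵘ p n
toℚᵘ-/ p n = ℚ.toℚᵘ-fromℚᵘ (ℚᵘ.mkℚᵘ p n)

/1≡ι : ∀ n → + n / 1 ≡ ι n
/1≡ι zero    = refl
/1≡ι (suc n) = trans (ℚ.toℚᵘ-injective eq) (cong (_+_ 1ℚ) (/1≡ι n))
  where
  open ℚᵘ.≃-Reasoning
  eq : ℚ.toℚᵘ (+ suc n / 1) ℚᵘ.≃ ℚ.toℚᵘ (1ℚ + + n / 1)
  eq = begin
    ℚ.toℚᵘ (+ suc n / 1)                  ≈⟨ toℚᵘ-/ (+ suc n) 0 ⟩
    ℚᵘ.mkℚᵘ (+ suc n) 0                   ≈⟨ ℚᵘ.*≡* (cong (ℤ._* + 1) (sym (cong (ℤ._+_ (+ 1)) (ℤ.*-identityʳ (+ n))))) ⟩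
    ℚᵘ.1ℚᵘ ℚᵘ.+ ℚᵘ.mkℚᵘ (+ n) 0           ≈⟨ ℚᵘ.+-congʳ ℚᵘ.1ℚᵘ (ℚᵘ.≃-sym (toℚᵘ-/ (+ n) 0)) ⟩
    ℚᵘ.1ℚᵘ ℚᵘ.+ ℚ.toℚᵘ (+ n / 1)          ≈⟨ ℚᵘ.≃-sym (ℚ.toℚᵘ-homo-+ 1ℚ (+ n / 1)) ⟩
    ℚ.toℚᵘ (1ℚ + + n / 1)                 ∎

inv*ι≡1 : ∀ m → inv (suc m) * ι (suc m) ≡ 1ℚ
inv*ι≡1 m = trans (cong (_*_ (inv (suc m))) (sym (/1≡ι (suc m)))) (ℚ.toℚᵘ-injective eq)
  where
  open ℚᵘ.≃-Reasoning
  eq : ℚ.toℚᵘ (inv (suc m) * (+ suc m / 1)) ℚᵘ.≃ ℚᵘ.1ℚᵘ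
  eq = begin
    ℚ.toℚᵘ (inv (suc m) * (+ suc m / 1))                  ≈⟨ ℚ.toℚᵘ-homo-* (inv (suc m)) (+ suc m / 1) ⟩
    ℚ.toℚᵘ (inv (suc m)) ℚᵘ.* ℚ.toℚᵘ (+ suc m / 1)        ≈⟨ ℚᵘ.*-cong (toℚᵘ-/ (+ 1) m) (toℚᵘ-/ (+ suc m) 0) ⟩
    ℚᵘ.mkℚᵘ (+ 1) m ℚᵘ.* ℚᵘ.mkℚᵘ (+ suc m) 0              ≈⟨ ℚᵘ.*≡* (trans (ℤ.*-identityʳ _) (trans (ℤ.*-identityˡ (+ suc m)) (trans (cong (λ z → + suc z) (sym (ℕ.*-identityʳ m))) (sym (ℤ.*-identityˡ (+ (suc m ℕ.* 1))))))) ⟩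
    ℚᵘ.1ℚᵘ                                                ∎

0≤inv : ∀ m → 0ℚ ≤ inv m
0≤inv zero    = ≤-refl
0≤inv (suc m) = ℚ.nonNegative⁻¹ (inv (suc m)) {{ℚ.normalize-nonNeg 1 (suc m)}}

inv-cancelˡ : ∀ m p → inv (suc m) * (ι (suc m) * p) ≡ p
inv-cancelˡ m p = trans (sym (ℚ.*-assoc (inv (suc m)) (ι (suc m)) p))
                        (trans (cong (_* p) (inv*ι≡1 m)) (ℚ.*-identityˡ p))

inv-* : ∀ m n → inv (m ℕ.* n) ≡ inv m * inv n
inv-* zero    n       = sym (ℚ.*-zeroˡ (inv n))
inv-* (suc m) zero    = trans (cong inv (ℕ.*-zeroʳ m)) (sym (ℚ.*-zeroʳ (inv (suc m))))
inv-* (suc m) (suc n) = begin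
  k                                 ≡⟨ sym (ℚ.*-identityʳ k) ⟩
  k * 1ℚ                            ≡⟨ cong (_*_ k) (sym (cong₂ _*_ (inv*ι≡1 m) (inv*ι≡1 n))) ⟩
  k * ((a * ι (suc m)) * (b * ι (suc n)))
    ≡⟨ solve 5 (λ k a x b y → k :* ((a :* x) :* (b :* y)) := (k :* (x :* y)) :* (a :* b)) refl k a (ι (suc m)) b (ι (suc n)) ⟩
  (k * (ι (suc m) * ι (suc n))) * (a * b)
    ≡⟨ cong (_* (a * b)) (trans (cong (_*_ k) (sym (ι-* (suc m) (suc n)))) (inv*ι≡1 (n ℕ.+ m ℕ.* suc n))) ⟩
  1ℚ * (a * b)                      ≡⟨ ℚ.*-identityˡ (a * b) ⟩
  a * b                             ∎
  where
  open ≡-Reasoning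
  k = inv (suc m ℕ.* suc n)
  a = inv (suc m)
  b = inv (suc n)

-- Averages over the elements of a vector

-- One draw without replacement. It follows positions, so no equality test on elements is involved,
-- and the rest keeps its order.
data Pick {A : Set} : ∀ {m} → A → Vec A m → Vec A (suc m) → Set where
  here  : ∀ {m x} {xs : Vec A m} → Pick x xs (x ∷ xs)
  there : ∀ {m x y} {ys : Vec A m} {xs} → Pick y ys xs → Pick y (x ∷ ys) (x ∷ xs)

-- The summand also sees the vector with its entry deleted, which is one shorter; hence the
-- one-element base case.
∑ : (A → Vec A m → ℚ) → Vec A (suc m) → ℚ
∑ {m = zero}  f (x ∷ []) = f x []
∑ {m = suc m} f (x ∷ xs) = f x xs + ∑ (λ y ys → f y (x ∷ ys)) xs

∑-mono : ∀ {f g : A → Vec A m → ℚ} R → (∀ x r → Pick x r R → f x r ≤ g x r) → ∑ f R ≤ ∑ g R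
∑-mono {m = zero}  (x ∷ []) f≤g = f≤g x [] here
∑-mono {m = suc m} (x ∷ xs) f≤g =
  ℚ.+-mono-≤ (f≤g x xs here) (∑-mono xs (λ y ys p → f≤g y (x ∷ ys) (there p)))

∑-cong : ∀ {f g : A → Vec A m → ℚ} R → (∀ x r → Pick x r R → f x r ≡ g x r) → ∑ f R ≡ ∑ g R
∑-cong {m = zero}  (x ∷ []) f≡g = f≡g x [] here
∑-cong {m = suc m} (x ∷ xs) f≡g =
  cong₂ _+_ (f≡g x xs here) (∑-cong xs (λ y ys p → f≡g y (x ∷ ys) (there p)))

∑-+ : ∀ (f g : A → Vec A m → ℚ) R → ∑ (λ x r → f x r + g x r) R ≡ ∑ f R + ∑ g R
∑-+ {m = zero}  f g (x ∷ []) = refl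
∑-+ {m = suc m} f g (x ∷ xs) =
  trans (cong (_+_ (f x xs + g x xs)) (∑-+ (λ y ys → f y (x ∷ ys)) (λ y ys → g y (x ∷ ys)) xs))
        (solve 4 (λ a b c d → (a :+ b) :+ (c :+ d) := (a :+ c) :+ (b :+ d)) refl
               (f x xs) (g x xs) _ _)

∑-* : ∀ c (f : A → Vec A m → ℚ) R → ∑ (λ x r → c * f x r) R ≡ c * ∑ f R
∑-* {m = zero}  c f (x ∷ []) = refl
∑-* {m = suc m} c f (x ∷ xs) =
  trans (cong (_+_ (c * f x xs)) (∑-* c (λ y ys → f y (x ∷ ys)) xs))
        (sym (ℚ.*-distribˡ-+ c (f x xs) _))

-- Both sides run over ordered pairs of distinct positions, and deleting two entries in either order
-- leaves the same vector.
∑-swap : ∀ (f : A → A → Vec A m → ℚ) R →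
  ∑ (λ x → ∑ (λ y → f x y)) R ≡ ∑ (λ x → ∑ (λ y → f y x)) R
∑-swap {m = zero}  f (x ∷ y ∷ []) = ℚ.+-comm (f x y []) (f y x [])
∑-swap {m = suc m} f (x ∷ xs) = begin
  a + ∑ (λ y ys → ∑ (λ z → f y z) (x ∷ ys)) xs
    ≡⟨ cong (_+_ a) (∑-+ (λ y ys → f y x ys) (λ y → ∑ (λ z zs → f y z (x ∷ zs))) xs) ⟩
  a + (b + c)
    ≡⟨ cong (λ t → a + (b + t)) (∑-swap (λ y z zs → f y z (x ∷ zs)) xs) ⟩
  a + (b + d)
    ≡⟨ solve 3 (λ a b d → a :+ (b :+ d) := b :+ (a :+ d)) refl a b d ⟩
  b + (a + d)
    ≡⟨ cong (_+_ b) (sym (∑-+ (λ y ys → f x y ys) (λ y → ∑ (λ z zs → f z y (x ∷ zs))) xs)) ⟩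
  b + ∑ (λ y ys → ∑ (λ z → f z y) (x ∷ ys)) xs ∎
  where
  open ≡-Reasoning
  a = ∑ (λ y ys → f x y ys) xs
  b = ∑ (λ y ys → f y x ys) xs
  c = ∑ (λ y → ∑ (λ z zs → f y z (x ∷ zs))) xs
  d = ∑ (λ y → ∑ (λ z zs → f z y (x ∷ zs))) xs

count : (A → Bool) → Vec A m → ℕ
count p []       = 0
count p (x ∷ xs) = (if p x then 1 else 0) ℕ.+ count p xs

count-pick : ∀ (p : A → Bool) {x} {r : Vec A m} {R} → Pick x r R →
             count p R ≡ (if p x then 1 else 0) ℕ.+ count p r
count-pick p here = refl
count-pick p {x} (there {x = y} {ys = ys} q) =
  trans (cong (ℕ._+_ i) (count-pick p q))
        (trans (sym (ℕ.+-assoc i j (count p ys)))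
               (trans (cong (ℕ._+ count p ys) (ℕ.+-comm i j)) (ℕ.+-assoc j i (count p ys))))
  where
  i = if p y then 1 else 0
  j = if p x then 1 else 0

count-mono : ∀ {p q : A → Bool} → (∀ x → p x ≡ true → q x ≡ true) → (R : Vec A m) →
             count p R ℕ.≤ count q R
count-mono p⇒q [] = ℕ.z≤n
count-mono {p = p} {q} p⇒q (x ∷ xs) with p x in px | q x in qx
... | true  | true  = ℕ.s≤s (count-mono p⇒q xs)
... | false | true  = ℕ.m≤n⇒m≤1+n (count-mono p⇒q xs)
... | false | false = count-mono p⇒q xs
... | true  | false with trans (sym qx) (p⇒q x px)
...   | ()

count-not : ∀ (p : A → Bool) (R : Vec A m) → count p R ℕ.+ count (λ x → not (p x)) R ≡ m
count-not p [] = refl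
count-not p (x ∷ xs) with p x
... | true  = cong suc (count-not p xs)
... | false = trans (ℕ.+-suc _ _) (cong suc (count-not p xs))

∑-if : ∀ (p : A → Bool) a b (R : Vec A (suc m)) →
  ∑ (λ x _ → if p x then a else b) R ≡ ι (count p R) * a + ι (count (λ x → not (p x)) R) * b
∑-if {m = zero} p a b (x ∷ []) with p x
... | true  = solve 2 (λ a b → a := (con 1ℚ :+ con 0ℚ) :* a :+ con 0ℚ :* b) refl a b
... | false = solve 2 (λ a b → b := con 0ℚ :* a :+ (con 1ℚ :+ con 0ℚ) :* b) refl a b
∑-if {m = suc m} p a b (x ∷ xs) with p x | ∑-if p a b xs
... | true  | eq = trans (cong (_+_ a) eq)
  (solve 4 (λ a b c d → a :+ (c :* a :+ d :* b) := (con 1ℚ :+ c) :* a :+ d :* b) refl a b (ι (count p xs)) (ι (count (λ x → not (p x)) xs)))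
... | false | eq = trans (cong (_+_ b) eq)
  (solve 4 (λ a b c d → b :+ (c :* a :+ d :* b) := c :* a :+ (con 1ℚ :+ d) :* b) refl a b (ι (count p xs)) (ι (count (λ x → not (p x)) xs)))

avg : (A → Vec A m → ℚ) → Vec A (suc m) → ℚ
avg {m = m} f R = inv (suc m) * ∑ f R

avg-mono : ∀ {f g : A → Vec A m → ℚ} R → (∀ x r → Pick x r R → f x r ≤ g x r) → avg f R ≤ avg g R
avg-mono {m = m} R f≤g = *-monoˡ-≤ (0≤inv (suc m)) (∑-mono R f≤g)

avg-cong : ∀ {f g : A → Vec A m → ℚ} R → (∀ x r → Pick x r R → f x r ≡ g x r) → avg f R ≡ avg g R
avg-cong {m = m} R f≡g = cong (_*_ (inv (suc m))) (∑-cong R f≡g)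

avg-+ : ∀ (f g : A → Vec A m → ℚ) R → avg (λ x r → f x r + g x r) R ≡ avg f R + avg g R
avg-+ {m = m} f g R =
  trans (cong (_*_ (inv (suc m))) (∑-+ f g R)) (ℚ.*-distribˡ-+ (inv (suc m)) (∑ f R) (∑ g R))

avg-* : ∀ c (f : A → Vec A m → ℚ) R → avg (λ x r → c * f x r) R ≡ c * avg f R
avg-* {m = m} c f R =
  trans (cong (_*_ (inv (suc m))) (∑-* c f R))
        (solve 3 (λ i c s → i :* (c :* s) := c :* (i :* s)) refl (inv (suc m)) c (∑ f R))

avg-const : ∀ c (R : Vec A (suc m)) → avg (λ _ _ → c) R ≡ c
avg-const {m = m} c R = trans (cong (_*_ (inv (suc m))) (trans (∑-if (λ _ → true) c c R) eq)) (inv-cancelˡ m c)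
  where
  eq : ι (count (λ _ → true) R) * c + ι (count (λ _ → false) R) * c ≡ ι (suc m) * c
  eq = trans (sym (ℚ.*-distribʳ-+ c (ι (count (λ _ → true) R)) (ι (count (λ _ → false) R))))
             (cong (_* c) (trans (sym (ι-+ (count (λ _ → true) R) _)) (cong ι (count-not (λ _ → true) R))))

-- Exchangeability of the first two elements of a random ordering; this is what lets an early
-- element be revealed late.
avg-swap : ∀ (f : A → A → Vec A m → ℚ) R →
  avg (λ x → avg (λ y → f x y)) R ≡ avg (λ x → avg (λ y → f y x)) R
avg-swap {m = m} f R =
  cong (_*_ (inv (suc (suc m))))
    (trans (∑-* (inv (suc m)) (λ x → ∑ (f x)) R)
      (trans (cong (_*_ (inv (suc m))) (∑-swap f R))
             (sym (∑-* (inv (suc m)) (λ x → ∑ (λ y → f y x)) R))))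

-- Random maximal chains

infixl 6 _▹_
_▹_ : Subset n → Fin n → Subset n
D ▹ x = D ∪ ⁅ x ⁆

▹-comm : ∀ (D : Subset n) x y → D ▹ x ▹ y ≡ D ▹ y ▹ x
▹-comm D x y = trans (∪-assoc D ⁅ x ⁆ ⁅ y ⁆)
  (trans (cong (D ∪_) (∪-comm ⁅ x ⁆ ⁅ y ⁆)) (sym (∪-assoc D ⁅ y ⁆ ⁅ x ⁆)))

⊆▹ : ∀ (D : Subset n) x → D ⊆ D ▹ x
⊆▹ D x z∈D = x∈p∪q⁺ (inj₁ z∈D)

∈▹ : ∀ (D : Subset n) x → x ∈ D ▹ x
∈▹ D x = x∈p∪q⁺ (inj₂ (x∈⁅x⁆ x))

∈▹⁻ : ∀ (D : Subset n) {x z} → z ∈ D ▹ x → z ∈ D ⊎ z ≡ x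
∈▹⁻ D {x} z∈ with x∈p∪q⁻ D ⁅ x ⁆ z∈
... | inj₁ z∈D = inj₁ z∈D
... | inj₂ z∈x = inj₂ (x∈⁅y⁆⇒x≡y x z∈x)

▹⊆ : ∀ {D B : Subset n} {x} → D ⊆ B → x ∈ B → D ▹ x ⊆ B
▹⊆ {D = D} D⊆B x∈B z∈ with ∈▹⁻ D z∈
... | inj₁ z∈D = D⊆B z∈D
... | inj₂ refl = x∈B

▹-mono : ∀ {C D : Subset n} x → C ⊆ D → C ▹ x ⊆ D ▹ x
▹-mono {D = D} x C⊆D = ▹⊆ (λ z∈C → ⊆▹ D x (C⊆D z∈C)) (∈▹ D x)

-- The expected total weight G picks up along a uniformly random maximal chain from D to D ∪ R.
chain : (Subset n → ℚ) → Subset n → Vec (Fin n) m → ℚ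
chain {m = zero}  G D R = G D
chain {m = suc m} G D R = G D + avg (λ x r → chain G (D ▹ x) r) R

module _ {n} {G H : Subset n → ℚ} where

  chain-mono : (∀ C → G C ≤ H C) → ∀ {m} D (R : Vec (Fin n) m) → chain G D R ≤ chain H D R
  chain-mono G≤H {zero}  D R = G≤H D
  chain-mono G≤H {suc m} D R =
    ℚ.+-mono-≤ (G≤H D) (avg-mono R (λ x r _ → chain-mono G≤H (D ▹ x) r))

  chain-+ : ∀ {m} D (R : Vec (Fin n) m) → chain (λ C → G C + H C) D R ≡ chain G D R + chain H D R
  chain-+ {zero}  D R = refl
  chain-+ {suc m} D R = trans
    (cong (_+_ (G D + H D)) (trans (avg-cong R (λ x r _ → chain-+ (D ▹ x) r))
      (avg-+ (λ x r → chain G (D ▹ x) r) (λ x r → chain H (D ▹ x) r) R)))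
    (solve 4 (λ a b c d → (a :+ b) :+ (c :+ d) := (a :+ c) :+ (b :+ d)) refl (G D) (H D) _ _)

  -- Adding `x` commutes with every step of the chain, so averaging over its presence passes through
  -- the recursion.
  chain-half : ∀ x → (∀ C → H C ≡ ½ * (G C + G (C ▹ x))) → ∀ {m} D (R : Vec (Fin n) m) →
               chain H D R ≡ ½ * (chain G D R + chain G (D ▹ x) R)
  chain-half x half {zero}  D R = half D
  chain-half x half {suc m} D R = begin
    H D + avg (λ y r → chain H (D ▹ y) r) R
      ≡⟨ cong₂ _+_ (half D) (avg-cong R (λ y r _ → trans (chain-half x half (D ▹ y) r)
           (cong (λ C → ½ * (chain G (D ▹ y) r + chain G C r)) (▹-comm D y x)))) ⟩
    ½ * (G D + G (D ▹ x)) + avg (λ y r → ½ * (f y r + g y r)) R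
      ≡⟨ cong (_+_ (½ * (G D + G (D ▹ x))))
           (trans (avg-* ½ (λ y r → f y r + g y r) R) (cong (_*_ ½) (avg-+ f g R))) ⟩
    ½ * (G D + G (D ▹ x)) + ½ * (avg f R + avg g R)
      ≡⟨ solve 5 (λ h a b c d → h :* (a :+ b) :+ h :* (c :+ d) := h :* ((a :+ c) :+ (b :+ d)))
           refl ½ (G D) (G (D ▹ x)) (avg f R) (avg g R) ⟩
    ½ * ((G D + avg f R) + (G (D ▹ x) + avg g R)) ∎
    where
    open ≡-Reasoning
    f g : Fin n → Vec (Fin n) m → ℚ
    f y r = chain G (D ▹ y) r
    g y r = chain G (D ▹ x ▹ y) r

module _ {n} {G : Subset n → ℚ} where

  chain-nonneg : (∀ C → 0ℚ ≤ G C) → ∀ {m} D (R : Vec (Fin n) m) → 0ℚ ≤ chain G D R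
  chain-nonneg 0≤G {zero}  D R = 0≤G D
  chain-nonneg 0≤G {suc m} D R = 0≤-+ (0≤G D)
    (≤-trans (≤-reflexive (sym (avg-const 0ℚ R))) (avg-mono R (λ x r _ → chain-nonneg 0≤G (D ▹ x) r)))

  module _ (G≤1 : ∀ C → G C ≤ 1ℚ) where

    chain≤length : ∀ {m} D (R : Vec (Fin n) m) → chain G D R ≤ ι (suc m)
    chain≤length {zero}  D R = G≤1 D
    chain≤length {suc m} D R = ℚ.+-mono-≤ (G≤1 D)
      (≤-trans (avg-mono R (λ x r _ → chain≤length (D ▹ x) r)) (≤-reflexive (avg-const (ι (suc m)) R)))

    -- Omit the last element of the chain: what remains is a random chain on `R` minus a uniformly
    -- random element, and only the top set, of weight at most 1, is lost. The induction peels the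
    -- first step and exchanges it with the omitted element.
    chain-exclude : ∀ {m} D (R : Vec (Fin n) (suc m)) → chain G D R ≤ 1ℚ + avg (λ x r → chain G D r) R
    chain-exclude {zero} D (x ∷ []) = begin
      G D + 1ℚ * G (D ▹ x)  ≡⟨ cong (_+_ (G D)) (ℚ.*-identityˡ (G (D ▹ x))) ⟩
      G D + G (D ▹ x)       ≡⟨ ℚ.+-comm (G D) (G (D ▹ x)) ⟩
      G (D ▹ x) + G D       ≤⟨ ℚ.+-monoˡ-≤ (G D) (G≤1 (D ▹ x)) ⟩
      1ℚ + G D              ≡⟨ cong (_+_ 1ℚ) (sym (ℚ.*-identityˡ (G D))) ⟩
      1ℚ + 1ℚ * G D         ∎
      where open ℚ.≤-Reasoning
    chain-exclude {suc m} D R = begin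
      G D + avg (λ x r → chain G (D ▹ x) r) R
        ≤⟨ ℚ.+-monoʳ-≤ (G D) (avg-mono R (λ x r _ → chain-exclude (D ▹ x) r)) ⟩
      G D + avg (λ x r → 1ℚ + avg (λ y s → chain G (D ▹ x) s) r) R
        ≡⟨ cong (_+_ (G D)) (trans (avg-+ (λ _ _ → 1ℚ) _ R) (cong₂ _+_ (avg-const 1ℚ R)
             (avg-swap (λ x y s → chain G (D ▹ x) s) R))) ⟩
      G D + (1ℚ + a)
        ≡⟨ solve 2 (λ g a → g :+ (con 1ℚ :+ a) := con 1ℚ :+ (g :+ a)) refl (G D) a ⟩
      1ℚ + (G D + a)
        ≡⟨ cong (λ t → 1ℚ + (t + a)) (sym (avg-const (G D) R)) ⟩
      1ℚ + (avg (λ _ _ → G D) R + a)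
        ≡⟨ cong (_+_ 1ℚ) (sym (avg-+ (λ _ _ → G D) _ R)) ⟩
      1ℚ + avg (λ x r → chain G D r) R ∎
      where
      open ℚ.≤-Reasoning
      a = avg (λ x → avg (λ y s → chain G (D ▹ y) s)) R

    -- The mean of two bounds: the drawn element comes first in the chain, at the cost of the bottom
    -- set, or last, at the cost of the top set.
    chain-draw : ∀ {m} D (R : Vec (Fin n) (suc m)) →
      chain G D R ≤ 1ℚ + avg (λ x r → ½ * (chain G D r + chain G (D ▹ x) r)) R
    chain-draw D R = begin
      c                        ≡⟨ solve 1 (λ c → c := con ½ :* (c :+ c)) refl c ⟩
      ½ * (c + c)              ≤⟨ *-monoˡ-≤ 0≤½ (ℚ.+-mono-≤ (ℚ.+-monoˡ-≤ (avg f R) (G≤1 D)) (chain-exclude D R)) ⟩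
      ½ * ((1ℚ + avg f R) + (1ℚ + avg g R))
        ≡⟨ solve 2 (λ a b → con ½ :* ((con 1ℚ :+ a) :+ (con 1ℚ :+ b)) := con 1ℚ :+ con ½ :* (b :+ a)) refl (avg f R) (avg g R) ⟩
      1ℚ + ½ * (avg g R + avg f R)
        ≡⟨ cong (_+_ 1ℚ) (trans (cong (_*_ ½) (sym (avg-+ g f R))) (sym (avg-* ½ _ R))) ⟩
      1ℚ + avg (λ x r → ½ * (g x r + f x r)) R ∎
      where
      open ℚ.≤-Reasoning
      c = chain G D R
      f g : Fin n → Vec (Fin n) _ → ℚ
      f x r = chain G (D ▹ x) r
      g x r = chain G D r

-- The Lubell function as an expected number of hits

pick-∈ : ∀ {x : A} {r : Vec A m} {R} → Pick x r R → x ∈ᵥ R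
pick-∈ here      = here refl
pick-∈ (there p) = there (pick-∈ p)

∈-pick⁺ : ∀ {x z : A} {r : Vec A m} {R} → Pick x r R → z ∈ᵥ r → z ∈ᵥ R
∈-pick⁺ here      z∈        = there z∈
∈-pick⁺ (there p) (here eq) = here eq
∈-pick⁺ (there p) (there z∈) = there (∈-pick⁺ p z∈)

∈-pick⁻ : ∀ {x z : A} {r : Vec A m} {R} → Pick x r R → z ∈ᵥ R → z ≡ x ⊎ z ∈ᵥ r
∈-pick⁻ here      (here eq)  = inj₁ eq
∈-pick⁻ here      (there z∈) = inj₂ z∈
∈-pick⁻ (there p) (here eq)  = inj₂ (here eq)
∈-pick⁻ (there p) (there z∈) = Sum.map₂ there (∈-pick⁻ p z∈)

Within : Subset n → Subset n → Vec (Fin n) m → Set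
Within B D R = ∀ {z} → z ∈ B → z ∈ D ⊎ z ∈ᵥ R

within-pick : ∀ {B D : Subset n} {x} {r : Vec (Fin n) m} {R} → Pick x r R → Within B D R → Within B (D ▹ x) r
within-pick {D = D} {x} p B⊆ z∈B with B⊆ z∈B
... | inj₁ z∈D = inj₁ (⊆▹ D x z∈D)
... | inj₂ z∈R with ∈-pick⁻ p z∈R
...   | inj₁ refl = inj₁ (∈▹ D x)
...   | inj₂ z∈r  = inj₂ z∈r

within-unpick : ∀ {B D : Subset n} {x} {r : Vec (Fin n) m} {R} → Pick x r R → Within B (D ▹ x) r → Within B D R
within-unpick {D = D} p B⊆ z∈B with B⊆ z∈B
... | inj₂ z∈r = inj₂ (∈-pick⁺ p z∈r)
... | inj₁ z∈Dx with ∈▹⁻ D z∈Dx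
...   | inj₁ z∈D  = inj₁ z∈D
...   | inj₂ refl = inj₂ (pick-∈ p)

_≟ₛ_ : DecidableEquality (Subset n)
_≟ₛ_ = Vec.≡-dec Bool._≟_

_∈?_ : (D : Subset n) (F : List (Subset n)) → Dec (D ∈ₗ F)
_∈?_ = mem? _≟ₛ_

χ : List (Subset n) → Subset n → ℚ
χ F D = if does (D ∈? F) then 1ℚ else 0ℚ

χ-∈ : ∀ {F : List (Subset n)} {D} → D ∈ₗ F → χ F D ≡ 1ℚ
χ-∈ {F = F} {D} D∈F = cong (if_then 1ℚ else 0ℚ) (dec-true (D ∈? F) D∈F)

χ-∉ : ∀ {F : List (Subset n)} {D} → ¬ (D ∈ₗ F) → χ F D ≡ 0ℚ
χ-∉ {F = F} {D} D∉F = cong (if_then 1ℚ else 0ℚ) (dec-false (D ∈? F) D∉F)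

0≤χ : ∀ (F : List (Subset n)) D → 0ℚ ≤ χ F D
0≤χ F D with does (D ∈? F)
... | true  = 0≤1
... | false = ≤-refl

χ≤1 : ∀ (F : List (Subset n)) D → χ F D ≤ 1ℚ
χ≤1 F D with does (D ∈? F)
... | true  = ≤-refl
... | false = 0≤1

chain-∅ : ∀ (F : List (Subset n)) D (R : Vec (Fin n) m) →
  (∀ B → B ∈ₗ F → D ⊆ B → ¬ (Within B D R)) → chain (χ F) D R ≤ 0ℚ
chain-∅ {m = zero}  F D R none = ≤-reflexive (χ-∉ (λ D∈F → none D D∈F ⊆-refl inj₁))
chain-∅ {m = suc m} F D R none = ℚ.+-mono-≤
  (≤-reflexive (χ-∉ (λ D∈F → none D D∈F ⊆-refl inj₁)))
  (≤-trans (avg-mono R (λ x r p → chain-∅ F (D ▹ x) r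
              (λ B B∈F Dx⊆B B⊆ → none B B∈F (λ z∈D → Dx⊆B (⊆▹ D x z∈D)) (within-unpick p B⊆))))
           (≤-reflexive (avg-const 0ℚ R)))

-- Induction through Pascal's rule. It yields both the probability of meeting a given set and the
-- recursion for central binomial coefficients.
absorption : ∀ m k → suc k ℕ.* (suc m choose suc k) ≡ suc m ℕ.* (m choose k)
absorption zero    zero    = refl
absorption zero    (suc k) = ℕ.*-zeroʳ (suc (suc k))
absorption (suc m) zero    = trans (ℕ.*-identityˡ _) (trans (nC1≡n (suc (suc m))) (sym (ℕ.*-identityʳ (suc (suc m)))))
absorption (suc m) (suc k) = begin
  suc (suc k) ℕ.* (suc (suc m) choose suc (suc k))
    ≡⟨ cong (suc (suc k) ℕ.*_) (sym (nCk+nC[k+1]≡[n+1]C[k+1] (suc m) (suc k))) ⟩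
  suc (suc k) ℕ.* (c ℕ.+ d)
    ≡⟨ ℕ.*-distribˡ-+ (suc (suc k)) c d ⟩
  (c ℕ.+ suc k ℕ.* c) ℕ.+ suc (suc k) ℕ.* d
    ≡⟨ cong₂ (λ a b → (c ℕ.+ a) ℕ.+ b) (absorption m k) (absorption m (suc k)) ⟩
  (c ℕ.+ suc m ℕ.* (m choose k)) ℕ.+ suc m ℕ.* (m choose suc k)
    ≡⟨ ℕ.+-assoc c _ _ ⟩
  c ℕ.+ (suc m ℕ.* (m choose k) ℕ.+ suc m ℕ.* (m choose suc k))
    ≡⟨ cong (c ℕ.+_) (sym (ℕ.*-distribˡ-+ (suc m) (m choose k) (m choose suc k))) ⟩
  c ℕ.+ suc m ℕ.* ((m choose k) ℕ.+ (m choose suc k))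
    ≡⟨ cong (λ t → c ℕ.+ suc m ℕ.* t) (nCk+nC[k+1]≡[n+1]C[k+1] m k) ⟩
  suc (suc m) ℕ.* c ∎
  where
  open ≡-Reasoning
  c = suc m choose suc k
  d = suc m choose suc (suc k)

inv-absorption : ∀ m a → inv (suc m) * (ι (suc a) * inv (m choose a)) ≡ inv (suc m choose suc a)
inv-absorption m a = begin
  inv (suc m) * (ι (suc a) * inv (m choose a))
    ≡⟨ solve 3 (λ x y z → x :* (y :* z) := y :* (x :* z)) refl (inv (suc m)) (ι (suc a)) (inv (m choose a)) ⟩
  ι (suc a) * (inv (suc m) * inv (m choose a))
    ≡⟨ cong (_*_ (ι (suc a))) (trans (sym (inv-* (suc m) (m choose a)))
         (trans (cong inv (sym (absorption m a))) (inv-* (suc a) (suc m choose suc a)))) ⟩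
  ι (suc a) * (inv (suc a) * inv (suc m choose suc a))
    ≡⟨ solve 3 (λ x y z → x :* (y :* z) := y :* (x :* z)) refl (ι (suc a)) (inv (suc a)) (inv (suc m choose suc a)) ⟩
  inv (suc a) * (ι (suc a) * inv (suc m choose suc a))
    ≡⟨ inv-cancelˡ a _ ⟩
  inv (suc m choose suc a) ∎
  where open ≡-Reasoning

∈⇒lookup : ∀ {B : Subset n} {z} → z ∈ B → lookup B z ≡ true
∈⇒lookup = Vec.[]=⇒lookup

lookup⇒∈ : ∀ {B : Subset n} {z} → lookup B z ≡ true → z ∈ B
lookup⇒∈ {B = B} {z} = Vec.lookup⇒[]= z B

∈ᵥ⇒pick : ∀ {z : A} {R : Vec A (suc m)} → z ∈ᵥ R → ∃ λ r → Pick z r R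
∈ᵥ⇒pick {R = x ∷ xs} (here refl) = xs , here
∈ᵥ⇒pick {m = suc m} {R = x ∷ xs} (there z∈) with ∈ᵥ⇒pick z∈
... | r , p = x ∷ r , there p

-- The chain meets `A` if its first step picks one of the a elements of `A` in `R` and the rest
-- meets `A`; the probabilities multiply to the claimed reciprocal by `inv-absorption`.
inv-choose≤chain : ∀ (A D : Subset n) (R : Vec (Fin n) m) → D ⊆ A → Within A D R →
  inv (m choose count (lookup A) R) ≤ chain (χ (A ∷ [])) D R
inv-choose≤chain {m = zero} A D [] D⊆A A⊆ =
  ≤-reflexive (sym (χ-∈ {F = A ∷ []} (here (⊆-antisym D⊆A A⊆D))))
  where
  A⊆D : A ⊆ D
  A⊆D z∈A with A⊆ z∈A
  ... | inj₁ z∈D = z∈D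
inv-choose≤chain {m = suc m} A D R D⊆A A⊆ with count (lookup A) R in eq
-- No element of `R` lies in `A`, so `A` is `D` itself and is met at the start.
... | zero = ≤-trans (≤-reflexive (sym (χ-∈ {F = A ∷ []} (here (⊆-antisym D⊆A A⊆D)))))
               (≤-by-difference _ (≤-trans (≤-reflexive (sym (avg-const 0ℚ R)))
                 (avg-mono R (λ x r _ → chain-nonneg (0≤χ (A ∷ [])) (D ▹ x) r))) refl)
  where
  A⊆D : A ⊆ D
  A⊆D {z} z∈A with A⊆ z∈A
  ... | inj₁ z∈D = z∈D
  ... | inj₂ z∈R with ∈ᵥ⇒pick z∈R
  ...   | r , p with trans (sym eq) (count-pick (lookup A) p)
  ...     | eq′ rewrite ∈⇒lookup z∈A with eq′
  ...       | ()
... | suc a = begin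
  inv (suc m choose suc a)
    ≡⟨ sym (inv-absorption m a) ⟩
  inv (suc m) * (ι (suc a) * c)
    ≡⟨ cong (_*_ (inv (suc m))) (trans (cong (λ t → ι t * c) (sym eq))
         (trans (solve 2 (λ x y → x := x :+ y :* con 0ℚ) refl (ι (count (lookup A) R) * c) (ι (count (λ x → not (lookup A x)) R)))
                (sym (∑-if (lookup A) c 0ℚ R)))) ⟩
  avg (λ x _ → if lookup A x then c else 0ℚ) R
    ≤⟨ avg-mono R step ⟩
  avg (λ x r → chain (χ (A ∷ [])) (D ▹ x) r) R
    ≤⟨ ≤-by-difference (χ (A ∷ []) D) (0≤χ (A ∷ []) D) (ℚ.+-comm (χ (A ∷ []) D) (avg (λ x r → chain (χ (A ∷ [])) (D ▹ x) r) R)) ⟩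
  χ (A ∷ []) D + avg (λ x r → chain (χ (A ∷ [])) (D ▹ x) r) R ∎
  where
  open ℚ.≤-Reasoning
  c = inv (m choose a)
  step : ∀ x r → Pick x r R → (if lookup A x then c else 0ℚ) ≤ chain (χ (A ∷ [])) (D ▹ x) r
  step x r p with lookup A x in Ax | trans (sym eq) (count-pick (lookup A) p)
  ... | false | _ = chain-nonneg (0≤χ (A ∷ [])) (D ▹ x) r
  ... | true  | eq′ with ℕ.suc-injective eq′
  ...   | refl = inv-choose≤chain A (D ▹ x) r (▹⊆ D⊆A (lookup⇒∈ Ax)) (within-pick p A⊆)

count-tabulate : ∀ {n} (f : Fin n → A) p (B : Subset n) → (∀ i → p (f i) ≡ lookup B i) →
                 count p (Vec.tabulate f) ≡ ∣ B ∣
count-tabulate f p []      eq = refl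
count-tabulate f p (b ∷ B) eq with p (f zero) | eq zero
... | true  | refl = cong suc (count-tabulate (λ i → f (suc i)) p B (λ i → eq (suc i)))
... | false | refl = count-tabulate (λ i → f (suc i)) p B (λ i → eq (suc i))

-- Linearity of expectation, one member at a time; uniqueness keeps the indicators of the head and
-- of the tail from overlapping.
lubell≤chain : ∀ n (F : List (Subset n)) → Unique F → lubell n F ≤ chain (χ F) ⊥ (allFin n)
lubell≤chain n []      []        = chain-nonneg (0≤χ []) ⊥ (allFin n)
lubell≤chain n (A ∷ F) (A∉F ∷ F!) = begin
  inv (n choose ∣ A ∣) + lubell n F
    ≤⟨ ℚ.+-mono-≤ (subst (λ k → inv (n choose k) ≤ chain (χ (A ∷ [])) ⊥ (allFin n))
                         (count-tabulate (λ i → i) (lookup A) A (λ i → refl))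
                         (inv-choose≤chain A ⊥ (allFin n) (λ z∈⊥ → ⊥-elim (∉⊥ z∈⊥)) (λ {z} _ → inj₂ (∈-allFin⁺ z))))
                  (lubell≤chain n F F!) ⟩
  chain (χ (A ∷ [])) ⊥ (allFin n) + chain (χ F) ⊥ (allFin n)
    ≡⟨ sym (chain-+ ⊥ (allFin n)) ⟩
  chain (λ C → χ (A ∷ []) C + χ F C) ⊥ (allFin n)
    ≤⟨ chain-mono χ-∷ ⊥ (allFin n) ⟩
  chain (χ (A ∷ F)) ⊥ (allFin n) ∎
  where
  open ℚ.≤-Reasoning
  χ-∷ : ∀ C → χ (A ∷ []) C + χ F C ≤ χ (A ∷ F) C
  χ-∷ C = go (C ≟ₛ A) (C ∈? F)
    where
    C∉[A] : C ≢ A → ¬ (C ∈ₗ A ∷ [])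
    C∉[A] C≢A (here eq) = C≢A eq
    C∉A∷F : C ≢ A → ¬ (C ∈ₗ F) → ¬ (C ∈ₗ A ∷ F)
    C∉A∷F C≢A C∉F (here eq)   = C≢A eq
    C∉A∷F C≢A C∉F (there C∈F) = C∉F C∈F
    go : Dec (C ≡ A) → Dec (C ∈ₗ F) → χ (A ∷ []) C + χ F C ≤ χ (A ∷ F) C
    go (yes refl) _ = ≤-reflexive
      (trans (cong₂ _+_ (χ-∈ {F = A ∷ []} (here refl)) (χ-∉ (λ A∈F → All.lookup A∉F A∈F refl)))
             (sym (χ-∈ {F = A ∷ F} (here refl))))
    go (no C≢A) (yes C∈F) = ≤-reflexive
      (trans (cong₂ _+_ (χ-∉ (C∉[A] C≢A)) (χ-∈ C∈F)) (sym (χ-∈ {F = A ∷ F} (there C∈F))))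
    go (no C≢A) (no C∉F) = ≤-reflexive
      (trans (cong₂ _+_ (χ-∉ (C∉[A] C≢A)) (χ-∉ C∉F)) (sym (χ-∉ {F = A ∷ F} (C∉A∷F C≢A C∉F))))

-- Reaching a state in which few elements are bad

module _ {A : Set} (k : ℕ) {m : ℕ} {p q : A → Bool} (p⇒q : ∀ x → p x ≡ true → q x ≡ true)
         (f : A → Vec A m → ℚ) (0≤f : ∀ x r → 0ℚ ≤ f x r) where

  -- Elements satisfying `p` make up at least a fraction 1/k of `R`, and each contributes at least
  -- 1. The weaker `q` lets badness at a later state be replaced by badness at an earlier one.
  1≤k*avg : ∀ R → (∀ x r → Pick x r R → p x ≡ true → 1ℚ ≤ f x r) → suc m ℕ.≤ k ℕ.* count p R →
            1ℚ ≤ ι k * avg (λ x r → if q x then f x r else 0ℚ) R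
  1≤k*avg R 1≤f m<kc = begin
    1ℚ                                        ≡⟨ sym (inv*ι≡1 m) ⟩
    inv (suc m) * ι (suc m)                   ≤⟨ *-monoˡ-≤ (0≤inv (suc m)) (ι-mono m<kc) ⟩
    inv (suc m) * ι (k ℕ.* c)                 ≡⟨ cong (_*_ (inv (suc m))) (ι-* k c) ⟩
    inv (suc m) * (ι k * ι c)                 ≡⟨ solve 4 (λ i k c d → i :* (k :* c) := k :* (i :* (c :* con 1ℚ :+ d :* con 0ℚ))) refl
                                                   (inv (suc m)) (ι k) (ι c) (ι (count (λ x → not (p x)) R)) ⟩
    ι k * (inv (suc m) * (ι c * 1ℚ + ι (count (λ x → not (p x)) R) * 0ℚ))
                                              ≡⟨ cong (λ t → ι k * (inv (suc m) * t)) (sym (∑-if p 1ℚ 0ℚ R)) ⟩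
    ι k * avg (λ x r → if p x then 1ℚ else 0ℚ) R
                                              ≤⟨ *-monoˡ-≤ (0≤ι k) (avg-mono R step) ⟩
    ι k * avg (λ x r → if q x then f x r else 0ℚ) R ∎
    where
    open ℚ.≤-Reasoning
    c = count p R
    step : ∀ x r → Pick x r R → (if p x then 1ℚ else 0ℚ) ≤ (if q x then f x r else 0ℚ)
    step x r x∈R with p x in px | q x in qx
    ... | true  | true  = 1≤f x r x∈R px
    ... | false | true  = 0≤f x r
    ... | false | false = ≤-refl
    ... | true  | false with trans (sym qx) (p⇒q x px)
    ...   | ()

module _ {n} (F : List (Subset n)) where

  -- A witness that x is good at D; in `shattered⇒copy` it becomes the image of a non-maximal
  -- element.
  Hit : Subset n → Fin n → Subset n → Set
  Hit D x A = x ∈ A × A ⊆ D ▹ x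

  hit? : ∀ D x → Dec (Any (Hit D x) F)
  hit? D x = any? (λ A → (x ∈ₛ? A) ×-dec (A ⊆? (D ▹ x))) F

  bad : Subset n → Fin n → Bool
  bad D x = not (does (hit? D x))

  ¬hit⇒bad : ∀ D x → ¬ Any (Hit D x) F → bad D x ≡ true
  ¬hit⇒bad D x ¬hit = cong not (dec-false (hit? D x) ¬hit)

  bad⇒¬hit : ∀ D x → bad D x ≡ true → ¬ Any (Hit D x) F
  bad⇒¬hit D x b with hit? D x
  ... | no ¬hit = ¬hit

  good⇒hit : ∀ D x → bad D x ≡ false → Any (Hit D x) F
  good⇒hit D x b with hit? D x
  ... | yes hit = hit

  hit-mono : ∀ {C D} x → C ⊆ D → Any (Hit C x) F → Any (Hit D x) F
  hit-mono {C} {D} x C⊆D = Any.map (λ (x∈A , A⊆) → x∈A , λ z∈A → ▹-mono x C⊆D (A⊆ z∈A))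

  bad-antimono : ∀ {C D} → C ⊆ D → ∀ x → bad D x ≡ true → bad C x ≡ true
  bad-antimono {C} {D} C⊆D x b = ¬hit⇒bad C x (λ hit → bad⇒¬hit D x b (hit-mono x C⊆D hit))

  bad⇒∉ : ∀ D x → bad D x ≡ true → ¬ (D ▹ x ∈ₗ F)
  bad⇒∉ D x b D▹x∈F = bad⇒¬hit D x b (lose D▹x∈F (∈▹ D x , λ z∈ → z∈))

  module _ (κ : ℕ) where

    private k = suc κ

    -- At most ⌈m/k⌉ bad elements are left; this threshold drops by at most one when m does.
    Stopped : ∀ {m} → Subset n → Vec (Fin n) m → Set
    Stopped {m} D R = k ℕ.* count (bad D) R ℕ.< m ℕ.+ k

    stopped? : ∀ {m} D (R : Vec (Fin n) m) → Dec (Stopped D R)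
    stopped? {m} D R = k ℕ.* count (bad D) R ℕ.<? m ℕ.+ k

    -- The probability that a random chain started at D reaches a stopped state before it meets F.
    escape : ∀ {m} → Subset n → Vec (Fin n) m → ℚ
    escape {zero}  D R = 1ℚ
    escape {suc m} D R =
      if does (stopped? D R) then 1ℚ else
      if does (D ∈? F) then 0ℚ else avg (λ x r → escape (D ▹ x) r) R

    0≤escape : ∀ {m} D (R : Vec (Fin n) m) → 0ℚ ≤ escape D R
    0≤escape {zero}  D R = 0≤1
    0≤escape {suc m} D R with does (stopped? D R) | does (D ∈? F)
    ... | true  | _     = 0≤1
    ... | false | true  = ≤-refl
    ... | false | false = ≤-trans (≤-reflexive (sym (avg-const 0ℚ R)))
                                  (avg-mono R (λ x r _ → 0≤escape (D ▹ x) r))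

    escape≤1 : ∀ {m} D (R : Vec (Fin n) m) → escape D R ≤ 1ℚ
    escape≤1 {zero}  D R = ≤-refl
    escape≤1 {suc m} D R with does (stopped? D R) | does (D ∈? F)
    ... | true  | _     = ≤-refl
    ... | false | true  = 0≤1
    ... | false | false = ≤-trans (avg-mono R (λ x r _ → escape≤1 (D ▹ x) r)) (≤-reflexive (avg-const 1ℚ R))

    escape-stopped : ∀ {m} D (R : Vec (Fin n) m) → Stopped D R → escape D R ≡ 1ℚ
    escape-stopped {zero}  D R s = refl
    escape-stopped {suc m} D R s = 
      cong (if_then 1ℚ else (if does (D ∈? F) then 0ℚ else avg (λ x r → escape (D ▹ x) r) R))
           (dec-true (stopped? D R) s)

    escape-unstopped : ∀ {m} D (R : Vec (Fin n) (suc m)) → ¬ Stopped D R →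
      escape D R ≡ (if does (D ∈? F) then 0ℚ else avg (λ x r → escape (D ▹ x) r) R)
    escape-unstopped D R ¬s =
      cong (if_then 1ℚ else (if does (D ∈? F) then 0ℚ else avg (λ x r → escape (D ▹ x) r) R))
           (dec-false (stopped? D R) ¬s)

    escape-step : ∀ {m} D (R : Vec (Fin n) (suc m)) → ¬ (D ∈ₗ F) →
                  avg (λ x r → escape (D ▹ x) r) R ≤ escape D R
    escape-step D R D∉F with does (stopped? D R) | D ∈? F
    ... | true  | _       = ≤-trans (avg-mono R (λ x r _ → escape≤1 (D ▹ x) r)) (≤-reflexive (avg-const 1ℚ R))
    ... | false | no _    = ≤-refl
    ... | false | yes D∈F = ⊥-elim (D∉F D∈F)

    -- The first element x of the chain may as well be revealed last: if x is still bad just before the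
    -- chain without x stops, then the chain with x has met no member of F containing x, and it stops too.
    bad-escape : ∀ {m} D (R : Vec (Fin n) (suc m)) → ¬ Stopped D R →
      1ℚ ≤ ι k * avg (λ x r → if bad D x then escape (D ▹ x) r else 0ℚ) R
    -- With one element left, at most one is bad and k < 1 + k, so the state is stopped already.
    bad-escape {zero} D R ¬s = ⊥-elim (¬s (ℕ.s≤s (ℕ.≤-trans (ℕ.*-monoʳ-≤ k count≤1) (ℕ.≤-reflexive (ℕ.*-identityʳ k)))))
      where
      count≤1 : count (bad D) R ℕ.≤ 1
      count≤1 = ℕ.≤-trans (ℕ.m≤m+n _ _) (ℕ.≤-reflexive (count-not (bad D) R))
    bad-escape {suc m} D R ¬s = begin
      1ℚ
        ≡⟨ sym (avg-const 1ℚ R) ⟩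
      avg (λ _ _ → 1ℚ) R
        -- Here `a` is the first step of the chain without `x`; `x` is inserted after it, and
        -- `avg-swap` then moves `x` to the front.
        ≤⟨ avg-mono R inner ⟩
      avg (λ a r → ι k * avg (λ x s → if bad D x then escape (D ▹ a ▹ x) s else 0ℚ) r) R
        ≡⟨ avg-* (ι k) _ R ⟩
      ι k * avg (λ a → avg (λ x s → if bad D x then escape (D ▹ a ▹ x) s else 0ℚ)) R
        ≡⟨ cong (_*_ (ι k)) (avg-swap (λ a x s → if bad D x then escape (D ▹ a ▹ x) s else 0ℚ) R) ⟩
      ι k * avg (λ x → avg (λ a s → if bad D x then escape (D ▹ a ▹ x) s else 0ℚ)) R
        ≤⟨ *-monoˡ-≤ (0≤ι k) (avg-mono R outer) ⟩
      ι k * avg (λ x r → if bad D x then escape (D ▹ x) r else 0ℚ) R ∎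
      where
      open ℚ.≤-Reasoning

      outer : ∀ x r → Pick x r R →
        avg (λ a s → if bad D x then escape (D ▹ a ▹ x) s else 0ℚ) r ≤ (if bad D x then escape (D ▹ x) r else 0ℚ)
      outer x r _ with bad D x in b
      ... | false = ≤-reflexive (avg-const 0ℚ r)
      -- A bad `x` means `D ▹ x` is not in `F`, so the escape probability there is at least its mean
      -- over the next step.
      ... | true  = ≤-trans (≤-reflexive (avg-cong r (λ a s _ → cong (λ C → escape C s) (▹-comm D a x))))
                            (escape-step (D ▹ x) r (bad⇒∉ D x b))

      inner : ∀ a r → Pick a r R → 1ℚ ≤ ι k * avg (λ x s → if bad D x then escape (D ▹ a ▹ x) s else 0ℚ) r
      inner a r a∈R with stopped? (D ▹ a) r
      ... | no ¬s′ = ≤-trans (bad-escape (D ▹ a) r ¬s′) (*-monoˡ-≤ (0≤ι k) (avg-mono r mono))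
        where
        mono : ∀ x s → Pick x s r → (if bad (D ▹ a) x then escape (D ▹ a ▹ x) s else 0ℚ)
                                  ≤ (if bad D x then escape (D ▹ a ▹ x) s else 0ℚ)
        mono x s _ with bad (D ▹ a) x in b′ | bad D x in b
        ... | true  | true  = ≤-refl
        ... | false | true  = 0≤escape (D ▹ a ▹ x) s
        ... | false | false = ≤-refl
        ... | true  | false with trans (sym b) (bad-antimono (⊆▹ D a) x b′)
        ...   | ()
      -- The state without `x` has m + 1 elements left, but inserting `x` leaves only m, for which
      -- the threshold is one lower. The cases are whether the lower threshold is met as well.
      ... | yes s′ with k ℕ.* count (bad (D ▹ a)) r ℕ.<? m ℕ.+ k
      -- Every choice of `x` gives a stopped state. As `D` was not stopped, k times the number of
      -- bad elements is at least m + 2 + k; removing `a` costs at most k, so enough remain that are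
      -- bad at `D`.
      ...   | yes lt = 1≤k*avg k (λ x b → b) (λ x s → escape (D ▹ a ▹ x) s) (λ x s → 0≤escape (D ▹ a ▹ x) s) r
        (λ x s x∈r _ → ≤-reflexive (sym (escape-stopped (D ▹ a ▹ x) s (ℕ.≤-<-trans (ℕ.*-monoʳ-≤ k (drop x s x∈r)) lt))))
        (ℕ.+-cancelˡ-≤ k _ _ (ℕ.≤-trans unstopped (ℕ.≤-trans (ℕ.*-monoʳ-≤ k remove) (ℕ.≤-reflexive (ℕ.*-suc k _)))))
        where
        drop : ∀ x s → Pick x s r → count (bad (D ▹ a ▹ x)) s ℕ.≤ count (bad (D ▹ a)) r
        drop x s x∈r = ℕ.≤-trans (count-mono (bad-antimono (⊆▹ (D ▹ a) x)) s)
                         (ℕ.≤-trans (ℕ.m≤n+m _ _) (ℕ.≤-reflexive (sym (count-pick (bad (D ▹ a)) x∈r))))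
        remove : count (bad D) R ℕ.≤ suc (count (bad D) r)
        remove with bad D a | count-pick (bad D) a∈R
        ... | true  | eq = ℕ.≤-reflexive eq
        ... | false | eq = ℕ.≤-trans (ℕ.≤-reflexive eq) (ℕ.n≤1+n _)
        unstopped : k ℕ.+ suc m ℕ.≤ k ℕ.* count (bad D) R
        unstopped = ℕ.≤-trans (ℕ.≤-reflexive (ℕ.+-comm k (suc m))) (ℕ.≤-trans (ℕ.n≤1+n _) (ℕ.≮⇒≥ ¬s))
      -- Now at least a fraction 1/k of `r` is bad at `D ▹ a`, and choosing such an `x` lowers the
      -- bad count by one, hence k times it by k, which suffices to stop.
      ...   | no ≮ = 1≤k*avg k (bad-antimono (⊆▹ D a)) (λ x s → escape (D ▹ a ▹ x) s) (λ x s → 0≤escape (D ▹ a ▹ x) s) r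
        (λ x s x∈r b → ≤-reflexive (sym (escape-stopped (D ▹ a ▹ x) s (stops x s x∈r b))))
        (ℕ.≤-trans (ℕ.≤-trans (ℕ.≤-reflexive (ℕ.+-comm 1 m)) (ℕ.+-monoʳ-≤ m (ℕ.s≤s ℕ.z≤n))) (ℕ.≮⇒≥ ≮))
        where
        stops : ∀ x s → Pick x s r → bad (D ▹ a) x ≡ true → Stopped (D ▹ a ▹ x) s
        stops x s x∈r b = ℕ.+-cancelˡ-< k _ _ (ℕ.≤-<-trans
          (ℕ.≤-trans (ℕ.+-monoʳ-≤ k (ℕ.*-monoʳ-≤ k (count-mono (bad-antimono (⊆▹ (D ▹ a) x)) s)))
            (ℕ.≤-reflexive (trans (sym (ℕ.*-suc k (count (bad (D ▹ a)) s))) (cong (k ℕ.*_) (sym eq)))))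
          (ℕ.<-≤-trans s′ (ℕ.≤-trans (ℕ.≤-reflexive (ℕ.+-comm (suc m) k)) (ℕ.+-monoʳ-≤ k
            (ℕ.≤-trans (ℕ.≤-reflexive (ℕ.+-comm 1 m)) (ℕ.+-monoʳ-≤ m (ℕ.s≤s ℕ.z≤n)))))))
          where
          eq : count (bad (D ▹ a)) r ≡ suc (count (bad (D ▹ a)) s)
          eq = trans (count-pick (bad (D ▹ a)) x∈r) (cong (λ t → (if t then 1 else 0) ℕ.+ count (bad (D ▹ a)) s) b)

    1≤k*avg-escape : ∀ {m} D (R : Vec (Fin n) (suc m)) → ¬ Stopped D R →
      1ℚ ≤ ι k * avg (λ x r → escape (D ▹ x) r) R
    1≤k*avg-escape D R ¬s = ≤-trans (bad-escape D R ¬s) (*-monoˡ-≤ (0≤ι k) (avg-mono R step))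
      where
      step : ∀ x r → Pick x r R → (if bad D x then escape (D ▹ x) r else 0ℚ) ≤ escape (D ▹ x) r
      step x r _ with bad D x
      ... | true  = ≤-refl
      ... | false = 0≤escape (D ▹ x) r

    module _ (P : ∀ {m} → Subset n → Vec (Fin n) m → Set)
             (P-pick : ∀ {m D x} {r : Vec (Fin n) m} {R} → Pick x r R → P D R → P (D ▹ x) r)
             (K : ℚ) (bound : ∀ {m} D (R : Vec (Fin n) m) → P D R → Stopped D R → chain (χ F) D R ≤ K)
             where

      -- A potential argument: `ι k * (1ℚ - escape D R)` is the allowance for hits before stopping.
      -- It is preserved on average at a miss and drops by at least 1 at a hit.
      chain≤escape : ∀ {m} D (R : Vec (Fin n) m) → P D R →
                     chain (χ F) D R ≤ K + ι k * (1ℚ - escape D R)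
      chain≤escape {zero} D [] pr = ≤-trans (bound D [] pr (ℕ.s≤s (ℕ.≤-trans (ℕ.≤-reflexive (ℕ.*-zeroʳ κ)) ℕ.z≤n)))
        (≤-reflexive (solve 2 (λ K k → K := K :+ k :* (con 1ℚ :- con 1ℚ)) refl K (ι k)))
      chain≤escape {suc m} D R pr with stopped? D R
      ... | yes s = ≤-trans (bound D R pr s)
        (≤-reflexive (trans (solve 2 (λ K k → K := K :+ k :* (con 1ℚ :- con 1ℚ)) refl K (ι k))
                            (cong (λ t → K + ι k * (1ℚ - t)) (sym (escape-stopped D R s)))))
      ... | no ¬s = go (D ∈? F) (escape-unstopped D R ¬s)
        where
        open ℚ.≤-Reasoning
        a = avg (λ x r → escape (D ▹ x) r) R
        rest : avg (λ x r → chain (χ F) (D ▹ x) r) R ≤ K + ι k * (1ℚ - a)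
        rest = begin
          avg (λ x r → chain (χ F) (D ▹ x) r) R
            ≤⟨ avg-mono R (λ x r p → chain≤escape (D ▹ x) r (P-pick p pr)) ⟩
          avg (λ x r → K + ι k * (1ℚ - escape (D ▹ x) r)) R
            ≡⟨ avg-cong R (λ x r _ → solve 3 (λ K k e → K :+ k :* (con 1ℚ :- e) := (K :+ k) :+ (:- k) :* e) refl
                                          K (ι k) (escape (D ▹ x) r)) ⟩
          avg (λ x r → (K + ι k) + (- ι k) * escape (D ▹ x) r) R
            ≡⟨ trans (avg-+ (λ _ _ → K + ι k) _ R)
                     (cong₂ _+_ (avg-const (K + ι k) R) (avg-* (- ι k) (λ x r → escape (D ▹ x) r) R)) ⟩
          (K + ι k) + (- ι k) * a
            ≡⟨ solve 3 (λ K k e → (K :+ k) :+ (:- k) :* e := K :+ k :* (con 1ℚ :- e)) refl K (ι k) a ⟩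
          K + ι k * (1ℚ - a) ∎
        go : (d : Dec (D ∈ₗ F)) → escape D R ≡ (if does d then 0ℚ else a) →
             chain (χ F) D R ≤ K + ι k * (1ℚ - escape D R)
        go (no D∉F) eq = begin
          χ F D + avg (λ x r → chain (χ F) (D ▹ x) r) R  ≤⟨ ℚ.+-mono-≤ (≤-reflexive (χ-∉ D∉F)) rest ⟩
          0ℚ + (K + ι k * (1ℚ - a))                      ≡⟨ ℚ.+-identityˡ _ ⟩
          K + ι k * (1ℚ - a)                             ≡⟨ cong (λ t → K + ι k * (1ℚ - t)) (sym eq) ⟩
          K + ι k * (1ℚ - escape D R)                    ∎
        -- At a hit `escape` is 0, so the allowance is the full k, while the next step keeps on
        -- average k(1 - a) with k·a ≥ 1; the difference pays for the hit.
        go (yes D∈F) eq = begin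
          χ F D + avg (λ x r → chain (χ F) (D ▹ x) r) R  ≤⟨ ℚ.+-mono-≤ (χ≤1 F D) rest ⟩
          1ℚ + (K + ι k * (1ℚ - a))
            ≤⟨ ≤-by-difference (ι k * a - 1ℚ) (≤⇒0≤- (1≤k*avg-escape D R ¬s))
                 (solve 3 (λ K k e → K :+ k :* (con 1ℚ :- con 0ℚ) := (con 1ℚ :+ (K :+ k :* (con 1ℚ :- e))) :+ (k :* e :- con 1ℚ))
                        refl K (ι k) a) ⟩
          K + ι k * (1ℚ - 0ℚ)                            ≡⟨ cong (λ t → K + ι k * (1ℚ - t)) (sym eq) ⟩
          K + ι k * (1ℚ - escape D R)                    ∎

      chain≤stopped+k : ∀ {m} D (R : Vec (Fin n) m) → P D R → chain (χ F) D R ≤ K + ι k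
      chain≤stopped+k D R pr = ≤-trans (chain≤escape D R pr)
        (≤-by-difference (ι k * escape D R) (0≤-* (0≤ι k) (0≤escape D R))
          (solve 3 (λ K k e → K :+ k := (K :+ k :* (con 1ℚ :- e)) :+ k :* e) refl K (ι k) (escape D R)))

-- Drawing good elements

avgᵇ : ∀ {i} → (Vec Bool i → ℚ) → ℚ
avgᵇ {zero}  f = f []
avgᵇ {suc i} f = ½ * (avgᵇ (λ I → f (false ∷ I)) + avgᵇ (λ I → f (true ∷ I)))

half-≤ : ∀ {a b c} → a ≤ c → b ≤ c → ½ * (a + b) ≤ c
half-≤ {c = c} a≤c b≤c = ≤-trans (*-monoˡ-≤ 0≤½ (ℚ.+-mono-≤ a≤c b≤c))
  (≤-reflexive (solve 1 (λ c → con ½ :* (c :+ c) := c) refl c))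

avgᵇ-mono : ∀ {i} {f g : Vec Bool i → ℚ} → (∀ I → f I ≤ g I) → avgᵇ f ≤ avgᵇ g
avgᵇ-mono {zero}  f≤g = f≤g []
avgᵇ-mono {suc i} f≤g = *-monoˡ-≤ 0≤½
  (ℚ.+-mono-≤ (avgᵇ-mono (λ I → f≤g (false ∷ I))) (avgᵇ-mono (λ I → f≤g (true ∷ I))))

avgᵇ-≤ : ∀ {i} {f : Vec Bool i → ℚ} {c} → (∀ I → f I ≤ c) → avgᵇ f ≤ c
avgᵇ-≤ {zero}  f≤c = f≤c []
avgᵇ-≤ {suc i} f≤c = half-≤ (avgᵇ-≤ (λ I → f≤c (false ∷ I))) (avgᵇ-≤ (λ I → f≤c (true ∷ I)))

module _ {n} (F : List (Subset n)) where

  select : ∀ {i} → Vec (Fin n) i → Vec Bool i → Subset n → Subset n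
  select []      []      C = C
  select (x ∷ X) (b ∷ I) C = select X I (if b then C ▹ x else C)

  -- The expected indicator after a uniformly random subset of the drawn elements is added: each of
  -- them stays undecided until all are drawn.
  blend : ∀ {i} → Vec (Fin n) i → Subset n → ℚ
  blend X C = avgᵇ (λ I → χ F (select X I C))

  blend≤1 : ∀ {i} (X : Vec (Fin n) i) C → blend X C ≤ 1ℚ
  blend≤1 X C = avgᵇ-≤ (λ I → χ≤1 F (select X I C))

  chain-blend : ∀ {i m} (X : Vec (Fin n) i) D (R : Vec (Fin n) m) →
                chain (blend X) D R ≡ avgᵇ (λ I → chain (χ F) (select X I D) R)
  chain-blend []      D R = refl
  chain-blend (x ∷ X) D R = trans (chain-half x (λ C → refl) D R)
    (cong (_*_ ½) (cong₂ _+_ (chain-blend X D R) (chain-blend X (D ▹ x) R)))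

  module _ (g : Fin n → Bool) (M : ℕ)
           (P : ∀ {i m} → Vec (Fin n) i → Subset n → Vec (Fin n) m → Set)
           (P-good : ∀ {i m x} {X : Vec (Fin n) i} {D} {r : Vec (Fin n) m} {R} →
                     Pick x r R → g x ≡ true → P X D R → P (x ∷ X) D r)
           (P-bad : ∀ {i m x} {X : Vec (Fin n) i} {D} {r : Vec (Fin n) m} {R} →
                    Pick x r R → P X D R → P X D r × P X (D ▹ x) r)
           (K : ℚ) (leaf : ∀ {i m} (X : Vec (Fin n) i) D (R : Vec (Fin n) m) → i ≡ M → P X D R → chain (blend X) D R ≤ K)
           where

    -- j (m + 1) / (y + 1) is the expected number of draws without replacement from m elements
    -- until j of the y good ones have shown up.
    chain-draws : ∀ {m i} j (X : Vec (Fin n) i) D (R : Vec (Fin n) m) → i ℕ.+ j ≡ M → P X D R →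
      j ℕ.≤ count g R → chain (blend X) D R ≤ K + ι j * ι (suc m) * inv (suc (count g R))
    chain-draws {m} {i} zero X D R eq pr _ = ≤-trans (leaf X D R (trans (sym (ℕ.+-identityʳ i)) eq) pr)
      (≤-reflexive (solve 3 (λ K a b → K := K :+ con 0ℚ :* a :* b) refl K (ι (suc m)) (inv (suc (count g R)))))
    chain-draws {zero} (suc j) X D [] eq pr ()
    chain-draws {suc m} {i} (suc j) X D R eq pr j<y with count g R in eqy | count-not g R
    ... | suc y′ | eqz = begin
      chain (blend X) D R
        ≤⟨ chain-draw (blend≤1 X) D R ⟩
      1ℚ + avg (λ x r → ½ * (chain (blend X) D r + chain (blend X) (D ▹ x) r)) R
        ≤⟨ ℚ.+-monoʳ-≤ 1ℚ (avg-mono R step) ⟩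
      1ℚ + avg (λ x r → if g x then c₁ else c₂) R
        ≡⟨ cong (λ t → 1ℚ + inv (suc m) * t) (trans (∑-if g c₁ c₂ R) (cong (λ t → ι t * c₁ + Z * c₂) eqy)) ⟩
      1ℚ + iN * (Y * c₁ + Z * c₂)
        -- Writing m + 1 as good plus bad makes the reciprocals cancel exactly, so the draw-count
        -- formula satisfies its recursion with equality.
        ≡⟨ cong (λ N → 1ℚ + iN * (Y * (K + J * N * v) + Z * (K + (1ℚ + J) * N * w))) N≡ ⟩
      1ℚ + iN * (Y * (K + J * (Y + Z) * v) + Z * (K + (1ℚ + J) * (Y + Z) * w))
        ≡⟨ solve 7 (λ i Y Z K J v w →
             con 1ℚ :+ i :* (Y :* (K :+ J :* (Y :+ Z) :* v) :+ Z :* (K :+ (con 1ℚ :+ J) :* (Y :+ Z) :* w))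
             := con 1ℚ :+ (i :* (Y :+ Z)) :* (K :+ J :* (v :* Y) :+ Z :* (con 1ℚ :+ J) :* w)) refl iN Y Z K J v w ⟩
      1ℚ + (iN * (Y + Z)) * (K + J * (v * Y) + Z * (1ℚ + J) * w)
        ≡⟨ cong₂ (λ a b → 1ℚ + a * (K + J * b + Z * (1ℚ + J) * w)) (trans (cong (_*_ iN) (sym N≡)) (inv*ι≡1 m)) (inv*ι≡1 y′) ⟩
      1ℚ + 1ℚ * (K + J * 1ℚ + Z * (1ℚ + J) * w)
        ≡⟨ solve 4 (λ K J Z w → con 1ℚ :+ con 1ℚ :* (K :+ J :* con 1ℚ :+ Z :* (con 1ℚ :+ J) :* w)
                              := K :+ (con 1ℚ :+ J) :* (con 1ℚ :+ Z :* w)) refl K J Z w ⟩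
      K + (1ℚ + J) * (1ℚ + Z * w)
        ≡⟨ cong (λ t → K + (1ℚ + J) * (t + Z * w)) (sym (inv*ι≡1 (suc y′))) ⟩
      K + (1ℚ + J) * (w * (1ℚ + Y) + Z * w)
        ≡⟨ solve 5 (λ K J Y Z w → K :+ (con 1ℚ :+ J) :* (w :* (con 1ℚ :+ Y) :+ Z :* w)
                                := K :+ (con 1ℚ :+ J) :* (con 1ℚ :+ (Y :+ Z)) :* w) refl K J Y Z w ⟩
      K + (1ℚ + J) * (1ℚ + (Y + Z)) * w
        ≡⟨ cong (λ N → K + (1ℚ + J) * (1ℚ + N) * w) (sym N≡) ⟩
      K + ι (suc j) * ι (suc (suc m)) * inv (suc (suc y′)) ∎
      where
      open ℚ.≤-Reasoning
      y = suc y′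
      Y = ι y
      Z = ι (count (λ x → not (g x)) R)
      J = ι j
      iN = inv (suc m)
      v = inv y
      w = inv (suc y)
      -- The inductive bounds after a good and after a bad draw: a good one leaves y - 1 good
      -- elements and j still wanted, a bad one leaves y and j + 1.
      c₁ = K + J * ι (suc m) * v
      c₂ = K + ι (suc j) * ι (suc m) * w
      N≡ : ι (suc m) ≡ Y + Z
      N≡ = trans (cong ι (sym eqz)) (ι-+ y _)
      step : ∀ x r → Pick x r R → ½ * (chain (blend X) D r + chain (blend X) (D ▹ x) r) ≤ (if g x then c₁ else c₂)
      step x r p with g x in gx | trans (sym eqy) (count-pick g p)
      ... | true | e = ≤-trans (≤-reflexive (sym (chain-half x (λ C → refl) D r)))
        (subst (λ t → chain (blend (x ∷ X)) D r ≤ K + J * ι (suc m) * inv t) (sym e)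
          (chain-draws j (x ∷ X) D r (trans (sym (ℕ.+-suc i j)) eq) (P-good p gx pr)
            (ℕ.≤-pred (ℕ.≤-trans j<y (ℕ.≤-reflexive e)))))
      ... | false | e = half-≤ (use D (proj₁ (P-bad p pr))) (use (D ▹ x) (proj₂ (P-bad p pr)))
        where
        use : ∀ C → P X C r → chain (blend X) C r ≤ c₂
        use C pr′ = subst (λ t → chain (blend X) C r ≤ K + ι (suc j) * ι (suc m) * inv (suc t)) (sym e)
          (chain-draws (suc j) X C r eq pr′ (ℕ.≤-trans j<y (ℕ.≤-reflexive e)))

-- The Sauer-Shelah lemma and binomial sums

size : ∀ {i} → (Vec Bool i → Bool) → ℕ
size {zero}  b = if b [] then 1 else 0
size {suc i} b = size (λ I → b (false ∷ I)) ℕ.+ size (λ I → b (true ∷ I))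

avgᵇ-size : ∀ {i} (b : Vec Bool i → Bool) L →
            ι (2 ℕ.^ i) * avgᵇ (λ I → if b I then L else 0ℚ) ≡ L * ι (size b)
avgᵇ-size {zero} b L with b []
... | true  = solve 1 (λ L → (con 1ℚ :+ con 0ℚ) :* L := L :* (con 1ℚ :+ con 0ℚ)) refl L
... | false = solve 1 (λ L → (con 1ℚ :+ con 0ℚ) :* con 0ℚ := L :* con 0ℚ) refl L
avgᵇ-size {suc i} b L = begin
  ι (2 ℕ.* 2 ℕ.^ i) * (½ * (x + y))
    ≡⟨ cong (_* (½ * (x + y))) (ι-* 2 (2 ℕ.^ i)) ⟩
  (ι 2 * p) * (½ * (x + y))
    ≡⟨ solve 3 (λ p x y → (con (ι 2) :* p) :* (con ½ :* (x :+ y)) := p :* x :+ p :* y) refl p x y ⟩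
  p * x + p * y
    ≡⟨ cong₂ _+_ (avgᵇ-size (λ I → b (false ∷ I)) L) (avgᵇ-size (λ I → b (true ∷ I)) L) ⟩
  L * ι s + L * ι t
    ≡⟨ sym (trans (cong (_*_ L) (ι-+ s t)) (ℚ.*-distribˡ-+ L (ι s) (ι t))) ⟩
  L * ι (s ℕ.+ t) ∎
  where
  open ≡-Reasoning
  p = ι (2 ℕ.^ i)
  x = avgᵇ (λ I → if b (false ∷ I) then L else 0ℚ)
  y = avgᵇ (λ I → if b (true ∷ I) then L else 0ℚ)
  s = size (λ I → b (false ∷ I))
  t = size (λ I → b (true ∷ I))

size-∨-∧ : ∀ {i} (b c : Vec Bool i → Bool) →
           size b ℕ.+ size c ≡ size (λ I → b I ∨ c I) ℕ.+ size (λ I → b I ∧ c I)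
size-∨-∧ {zero} b c with b [] | c []
... | true  | true  = refl
... | true  | false = refl
... | false | true  = refl
... | false | false = refl
size-∨-∧ {suc i} b c = begin
  (b₀ ℕ.+ b₁) ℕ.+ (c₀ ℕ.+ c₁)  ≡⟨ interchange b₀ b₁ c₀ c₁ ⟩
  (b₀ ℕ.+ c₀) ℕ.+ (b₁ ℕ.+ c₁)  ≡⟨ cong₂ ℕ._+_ (size-∨-∧ (λ I → b (false ∷ I)) (λ I → c (false ∷ I)))
                                              (size-∨-∧ (λ I → b (true ∷ I)) (λ I → c (true ∷ I))) ⟩
  (u₀ ℕ.+ v₀) ℕ.+ (u₁ ℕ.+ v₁)  ≡⟨ interchange u₀ v₀ u₁ v₁ ⟩
  (u₀ ℕ.+ u₁) ℕ.+ (v₀ ℕ.+ v₁)  ∎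
  where
  open ≡-Reasoning
  interchange : ∀ p q r s → (p ℕ.+ q) ℕ.+ (r ℕ.+ s) ≡ (p ℕ.+ r) ℕ.+ (q ℕ.+ s)
  interchange = ℕ-Solver.solve 4 (λ p q r s → (p :+ℕ q) :+ℕ (r :+ℕ s) :=ℕ (p :+ℕ r) :+ℕ (q :+ℕ s)) refl
  b₀ = size (λ I → b (false ∷ I))
  b₁ = size (λ I → b (true ∷ I))
  c₀ = size (λ I → c (false ∷ I))
  c₁ = size (λ I → c (true ∷ I))
  u₀ = size (λ I → b (false ∷ I) ∨ c (false ∷ I))
  u₁ = size (λ I → b (true ∷ I) ∨ c (true ∷ I))
  v₀ = size (λ I → b (false ∷ I) ∧ c (false ∷ I))
  v₁ = size (λ I → b (true ∷ I) ∧ c (true ∷ I))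

-- The sum of the binomials C(M, j) over j < r, generated by Pascal's rule so that it matches the
-- Sauer-Shelah induction.
chooseSum : ℕ → ℕ → ℕ
chooseSum M       zero    = 0
chooseSum zero    (suc r) = 1
chooseSum (suc M) (suc r) = chooseSum M (suc r) ℕ.+ chooseSum M r

Shatters : ∀ {i} → (Vec Bool i → Bool) → ℕ → Set
Shatters {i} b r = ∃ λ (θ : Fin r → Fin i) → (∀ j k → θ j ≡ θ k → j ≡ k) ×
  (∀ (t : Fin r → Bool) → ∃ λ I → b I ≡ true × (∀ j → lookup I (θ j) ≡ t j))

size≡0⊎nonempty : ∀ {i} (b : Vec Bool i → Bool) → size b ℕ.≤ 0 ⊎ ∃ λ I → b I ≡ true
size≡0⊎nonempty {zero} b with b [] in eq
... | true  = inj₂ ([] , eq)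
... | false = inj₁ ℕ.z≤n
size≡0⊎nonempty {suc i} b with size≡0⊎nonempty (λ I → b (false ∷ I)) | size≡0⊎nonempty (λ I → b (true ∷ I))
... | inj₂ (I , bI) | _             = inj₂ (false ∷ I , bI)
... | inj₁ _        | inj₂ (I , bI) = inj₂ (true ∷ I , bI)
... | inj₁ s₀       | inj₁ s₁       = inj₁ (ℕ.+-mono-≤ s₀ s₁)

∧-both : ∀ (f : Bool → Bool) → f false ∧ f true ≡ true → ∀ c → f c ≡ true
∧-both f f∧ c with f false in f₀ | f true in f₁
∧-both f f∧ false | true | true = f₀
∧-both f f∧ true  | true | true = f₁

-- Split on the first coordinate and replace the two halves by their union and intersection, which
-- have the same total size. A set shattered by the union is shattered by the family; one shattered
-- by the intersection can be enlarged by the first coordinate.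
sauer-shelah : ∀ {i} r (b : Vec Bool i → Bool) → size b ℕ.≤ chooseSum i r ⊎ Shatters b r
sauer-shelah zero b with size≡0⊎nonempty b
... | inj₁ s        = inj₁ (ℕ.≤-trans s ℕ.z≤n)
... | inj₂ (I , bI) = inj₂ ((λ ()) , (λ ()) , λ t → I , bI , λ ())
sauer-shelah {zero} (suc r) b with b []
... | true  = inj₁ ℕ.≤-refl
... | false = inj₁ ℕ.z≤n
sauer-shelah {suc i} (suc r) b
  with sauer-shelah (suc r) (λ I → b (false ∷ I) ∨ b (true ∷ I))
     | sauer-shelah r (λ I → b (false ∷ I) ∧ b (true ∷ I))
... | inj₁ s∪ | inj₁ s∩ = inj₁ (ℕ.≤-trans
  (ℕ.≤-reflexive (size-∨-∧ (λ I → b (false ∷ I)) (λ I → b (true ∷ I)))) (ℕ.+-mono-≤ s∪ s∩))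
... | inj₂ (θ , θ-inj , sh) | _ = inj₂ ((λ j → suc (θ j)) , (λ j k eq → θ-inj j k (Fin.suc-injective eq)) , extend)
  where
  extend : ∀ t → ∃ λ I → b I ≡ true × (∀ j → lookup I (suc (θ j)) ≡ t j)
  extend t with sh t
  ... | I , bI , It with b (false ∷ I) in b₀
  ...   | true  = false ∷ I , b₀ , It
  ...   | false = true ∷ I , bI , It
... | inj₁ _ | inj₂ (θ , θ-inj , sh) = inj₂ (θ′ , θ′-inj , extend)
  where
  θ′ : Fin (suc r) → Fin (suc i)
  θ′ zero    = zero
  θ′ (suc j) = suc (θ j)
  θ′-inj : ∀ j k → θ′ j ≡ θ′ k → j ≡ k
  θ′-inj zero    zero    _  = refl
  θ′-inj (suc j) (suc k) eq = cong suc (θ-inj j k (Fin.suc-injective eq))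
  extend : ∀ t → ∃ λ I → b I ≡ true × (∀ j → lookup I (θ′ j) ≡ t j)
  extend t with sh (λ j → t (suc j))
  ... | I , bI , It = t zero ∷ I , ∧-both (λ c → b (c ∷ I)) bI (t zero) , λ { zero → refl ; (suc j) → It j }

chooseSum-full : ∀ M k → M ℕ.< k → chooseSum M k ≡ 2 ℕ.^ M
chooseSum-full zero    (suc k) _           = refl
chooseSum-full (suc M) (suc k) (ℕ.s≤s M<k) =
  trans (cong₂ ℕ._+_ (chooseSum-full M (suc k) (ℕ.m≤n⇒m≤1+n M<k)) (chooseSum-full M k M<k))
        (cong (2 ℕ.^ M ℕ.+_) (sym (ℕ.+-identityʳ (2 ℕ.^ M))))

-- By C(M, l) = C(M, M - l) the second sum is the tail complementary to the first. The induction
-- uses Pascal's rule, pairing the four terms crosswise.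
chooseSum-symmetric : ∀ M i j → i ℕ.+ j ≡ suc M → chooseSum M i ℕ.+ chooseSum M j ≡ 2 ℕ.^ M
chooseSum-symmetric M zero j refl = chooseSum-full M (suc M) ℕ.≤-refl
chooseSum-symmetric M (suc i) zero eq =
  trans (ℕ.+-identityʳ _) (chooseSum-full M (suc i) (ℕ.≤-reflexive (sym (trans (sym (ℕ.+-identityʳ (suc i))) eq))))
chooseSum-symmetric zero (suc i) (suc j) eq with trans (sym (ℕ.+-suc i j)) (ℕ.suc-injective eq)
... | ()
chooseSum-symmetric (suc M) (suc i) (suc j) eq = begin
  (a ℕ.+ b) ℕ.+ (c ℕ.+ d)
    ≡⟨ ℕ-Solver.solve 4 (λ a b c d → (a :+ℕ b) :+ℕ (c :+ℕ d) :=ℕ (a :+ℕ d) :+ℕ (b :+ℕ c)) refl a b c d ⟩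
  (a ℕ.+ d) ℕ.+ (b ℕ.+ c)
    ≡⟨ cong₂ ℕ._+_ (chooseSum-symmetric M (suc i) j (trans (sym (ℕ.+-suc i j)) (ℕ.suc-injective eq)))
                   (trans (chooseSum-symmetric M i (suc j) (ℕ.suc-injective eq)) (sym (ℕ.+-identityʳ (2 ℕ.^ M)))) ⟩
  2 ℕ.^ suc M ∎
  where
  open ≡-Reasoning
  a = chooseSum M (suc i)
  b = chooseSum M i
  c = chooseSum M (suc j)
  d = chooseSum M j

chooseSum-suc : ∀ M r → chooseSum M (suc r) ≡ chooseSum M r ℕ.+ (M choose r)
chooseSum-suc zero    zero    = refl
chooseSum-suc zero    (suc r) = refl
chooseSum-suc (suc M) zero    = trans (ℕ.+-identityʳ _) (chooseSum-suc M zero)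
chooseSum-suc (suc M) (suc r) = begin
  chooseSum M (suc (suc r)) ℕ.+ chooseSum M (suc r)
    ≡⟨ cong₂ ℕ._+_ (chooseSum-suc M (suc r)) (chooseSum-suc M r) ⟩
  (a ℕ.+ (M choose suc r)) ℕ.+ (b ℕ.+ (M choose r))
    ≡⟨ ℕ-Solver.solve 4 (λ a b c d → (a :+ℕ c) :+ℕ (b :+ℕ d) :=ℕ (a :+ℕ b) :+ℕ (d :+ℕ c)) refl a b (M choose suc r) (M choose r) ⟩
  (a ℕ.+ b) ℕ.+ ((M choose r) ℕ.+ (M choose suc r))
    ≡⟨ cong ((a ℕ.+ b) ℕ.+_) (nCk+nC[k+1]≡[n+1]C[k+1] M r) ⟩
  (a ℕ.+ b) ℕ.+ (suc M choose suc r) ∎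
  where
  open ≡-Reasoning
  a = chooseSum M (suc r)
  b = chooseSum M r

central : ℕ → ℕ
central r = (r ℕ.+ r) choose r

chooseSum-central : ∀ r → 2 ℕ.* chooseSum (r ℕ.+ r) r ℕ.+ central r ≡ 2 ℕ.^ (r ℕ.+ r)
chooseSum-central r = begin
  2 ℕ.* s ℕ.+ c             ≡⟨ cong (ℕ._+ c) (cong (s ℕ.+_) (ℕ.+-identityʳ s)) ⟩
  (s ℕ.+ s) ℕ.+ c           ≡⟨ ℕ.+-assoc s s c ⟩
  s ℕ.+ (s ℕ.+ c)           ≡⟨ cong (s ℕ.+_) (sym (chooseSum-suc (r ℕ.+ r) r)) ⟩
  s ℕ.+ chooseSum (r ℕ.+ r) (suc r) ≡⟨ chooseSum-symmetric (r ℕ.+ r) r (suc r) (ℕ.+-suc r r) ⟩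
  2 ℕ.^ (r ℕ.+ r)           ∎
  where
  open ≡-Reasoning
  s = chooseSum (r ℕ.+ r) r
  c = central r

-- Absorption, the symmetry C(2r+1, r) = C(2r+1, r+1), and absorption again.
central-suc : ∀ r → suc r ℕ.* central (suc r) ≡ 2 ℕ.* (suc (r ℕ.+ r) ℕ.* central r)
central-suc r = begin
  suc r ℕ.* central (suc r)
    ≡⟨ cong (λ t → suc r ℕ.* (suc t choose suc r)) (ℕ.+-suc r r) ⟩
  suc r ℕ.* (suc (suc (r ℕ.+ r)) choose suc r)
    ≡⟨ absorption (suc (r ℕ.+ r)) r ⟩
  suc (suc (r ℕ.+ r)) ℕ.* (suc (r ℕ.+ r) choose r)
    ≡⟨ cong (suc (suc (r ℕ.+ r)) ℕ.*_) (trans (nCk≡nC[n∸k] (ℕ.m≤n⇒m≤1+n (ℕ.m≤m+n r r)))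
         (cong (suc (r ℕ.+ r) choose_) (trans (cong (ℕ._∸ r) (sym (ℕ.+-suc r r))) (ℕ.m+n∸m≡n r (suc r))))) ⟩
  suc (suc (r ℕ.+ r)) ℕ.* (suc (r ℕ.+ r) choose suc r)
    ≡⟨ ℕ-Solver.solve 2 (λ r c → (con′ 2 :+ℕ (r :+ℕ r)) :*ℕ c :=ℕ con′ 2 :*ℕ ((con′ 1 :+ℕ r) :*ℕ c)) refl r (suc (r ℕ.+ r) choose suc r) ⟩
  2 ℕ.* (suc r ℕ.* (suc (r ℕ.+ r) choose suc r))
    ≡⟨ cong (2 ℕ.*_) (absorption (r ℕ.+ r) r) ⟩
  2 ℕ.* (suc (r ℕ.+ r) ℕ.* central r) ∎
  where
  open ≡-Reasoning

-- The estimate 4^r ≤ 2√r · C(2r, r), squared to stay within ℕ. From r to r + 1 the left side grows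
-- by the factor 16.
4^r≤central : ∀ r → 1 ℕ.≤ r → 2 ℕ.^ (r ℕ.+ r) ℕ.* 2 ℕ.^ (r ℕ.+ r) ℕ.≤ 4 ℕ.* r ℕ.* (central r ℕ.* central r)
4^r≤central (suc zero)    _ = ℕ.≤-refl
4^r≤central (suc (suc s)) _ = ℕ.*-cancelˡ-≤ (suc r) (begin
  suc r ℕ.* (q ℕ.* q)
    ≡⟨ cong (λ t → suc r ℕ.* (t ℕ.* t)) (cong (λ t → 2 ℕ.* 2 ℕ.^ t) (ℕ.+-suc r r)) ⟩
  suc r ℕ.* ((2 ℕ.* (2 ℕ.* p)) ℕ.* (2 ℕ.* (2 ℕ.* p)))
    ≡⟨ ℕ-Solver.solve 2 (λ r p → (con′ 1 :+ℕ r) :*ℕ ((con′ 2 :*ℕ (con′ 2 :*ℕ p)) :*ℕ (con′ 2 :*ℕ (con′ 2 :*ℕ p)))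
                              :=ℕ (con′ 16 :*ℕ (con′ 1 :+ℕ r)) :*ℕ (p :*ℕ p)) refl r p ⟩
  (16 ℕ.* suc r) ℕ.* (p ℕ.* p)
    ≤⟨ ℕ.*-monoʳ-≤ (16 ℕ.* suc r) (4^r≤central (suc s) (ℕ.s≤s ℕ.z≤n)) ⟩
  (16 ℕ.* suc r) ℕ.* (4 ℕ.* r ℕ.* (c ℕ.* c))
    -- The slack comes from (2r + 1)² = 4r(r + 1) + 1.
    ≤⟨ ℕ.m≤n+m _ (16 ℕ.* (c ℕ.* c)) ⟩
  16 ℕ.* (c ℕ.* c) ℕ.+ (16 ℕ.* suc r) ℕ.* (4 ℕ.* r ℕ.* (c ℕ.* c))
    ≡⟨ ℕ-Solver.solve 2 (λ r c → con′ 16 :*ℕ (c :*ℕ c) :+ℕ (con′ 16 :*ℕ (con′ 1 :+ℕ r)) :*ℕ (con′ 4 :*ℕ r :*ℕ (c :*ℕ c))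
         :=ℕ con′ 4 :*ℕ ((con′ 2 :*ℕ ((con′ 1 :+ℕ (r :+ℕ r)) :*ℕ c)) :*ℕ (con′ 2 :*ℕ ((con′ 1 :+ℕ (r :+ℕ r)) :*ℕ c)))) refl r c ⟩
  4 ℕ.* ((2 ℕ.* (suc (r ℕ.+ r) ℕ.* c)) ℕ.* (2 ℕ.* (suc (r ℕ.+ r) ℕ.* c)))
    ≡⟨ cong (λ t → 4 ℕ.* (t ℕ.* t)) (sym (central-suc r)) ⟩
  4 ℕ.* ((suc r ℕ.* d) ℕ.* (suc r ℕ.* d))
    ≡⟨ ℕ-Solver.solve 2 (λ r d → con′ 4 :*ℕ ((r :*ℕ d) :*ℕ (r :*ℕ d)) :=ℕ r :*ℕ (con′ 4 :*ℕ r :*ℕ (d :*ℕ d))) refl (suc r) d ⟩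
  suc r ℕ.* (4 ℕ.* suc r ℕ.* (d ℕ.* d)) ∎)
  where
  open ℕ.≤-Reasoning
  r = suc s
  p = 2 ℕ.^ (r ℕ.+ r)
  q = 2 ℕ.^ (suc r ℕ.+ suc r)
  c = central r
  d = central (suc r)

density : ℕ → ℕ → ℚ
density M r = ι (chooseSum M r) * inv (2 ℕ.^ M)

density-def : ∀ M r → ι (chooseSum M r) * inv (2 ℕ.^ M) ≡ density M r
density-def M r = refl

-- Shattered sets yield copies

all-pick : ∀ {P : A → Set} {x} {r : Vec A m} {R} → Pick x r R → VAll.All P R → P x × VAll.All P r
all-pick here      (px ∷ pxs) = px , pxs
all-pick (there p) (py ∷ pys) with all-pick p pys
... | px , pr = px , py ∷ pr

distinct-pick : ∀ {x : A} {r : Vec A m} {R} → Pick x r R → Distinct R → Distinct r × ¬ (x ∈ᵥ r)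
distinct-pick here (x∉ ∷ d) = d , λ x∈ → VAll.lookup x∉ x∈ refl
distinct-pick (there p) (y∉ ∷ d) with distinct-pick p d | all-pick p y∉
... | d′ , x∉ | y≢x , y∉r = y∉r ∷ d′ , λ { (here x≡y) → y≢x (sym x≡y) ; (there x∈) → x∉ x∈ }

map≡ : ∀ {B : Set} (f : A → B) (X : Vec A m) I → (∀ j → f (lookup X j) ≡ lookup I j) → Vec.map f X ≡ I
map≡ f []      []      eq = refl
map≡ f (x ∷ X) (b ∷ I) eq = cong₂ _∷_ (eq zero) (map≡ f X I (λ j → eq (suc j)))

-- Makes the pair describe a genuine interval from `D` to `D` ∪ `R` of dimension m.
Fresh : Subset n → Vec (Fin n) m → Set
Fresh D R = Distinct R × (∀ {x} → x ∈ᵥ R → x ∉ D)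

fresh-skip : ∀ {D : Subset n} {x} {r : Vec (Fin n) m} {R} → Pick x r R → Fresh D R → Fresh D r
fresh-skip p (d , R∉D) = proj₁ (distinct-pick p d) , λ z∈r → R∉D (∈-pick⁺ p z∈r)

fresh-▹ : ∀ {D : Subset n} {x} {R : Vec (Fin n) m} → Fresh D R → ¬ (x ∈ᵥ R) → Fresh (D ▹ x) R
fresh-▹ {D = D} {x} (d , R∉D) x∉R = d , λ z∈R z∈Dx → Sum.[ R∉D z∈R , (λ { refl → x∉R z∈R }) ] (∈▹⁻ D z∈Dx)

fresh-pick : ∀ {D : Subset n} {x} {r : Vec (Fin n) m} {R} → Pick x r R → Fresh D R → Fresh (D ▹ x) r
fresh-pick p f@(d , _) = fresh-▹ (fresh-skip p f) (proj₂ (distinct-pick p d))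

inv*ι : ∀ m → 1 ℕ.≤ m → inv m * ι m ≡ 1ℚ
inv*ι (suc m) _ = inv*ι≡1 m

module _ {n} (F : List (Subset n)) where

  ⊆select : ∀ {i} (X : Vec (Fin n) i) I D → D ⊆ select F X I D
  ⊆select []      []          D z∈ = z∈
  ⊆select (x ∷ X) (false ∷ I) D z∈ = ⊆select X I D z∈
  ⊆select (x ∷ X) (true ∷ I)  D z∈ = ⊆select X I (D ▹ x) (⊆▹ D x z∈)

  ∈select⁺ : ∀ {i} (X : Vec (Fin n) i) I D j → lookup I j ≡ true → lookup X j ∈ select F X I D
  ∈select⁺ (x ∷ X) (true ∷ I) D zero    _  = ⊆select X I (D ▹ x) (∈▹ D x)
  ∈select⁺ (x ∷ X) (b ∷ I)    D (suc j) Ij = ∈select⁺ X I (if b then D ▹ x else D) j Ij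

  ∈select⁻ : ∀ {i} (X : Vec (Fin n) i) I D {z} → z ∈ select F X I D →
             z ∈ D ⊎ ∃ λ j → z ≡ lookup X j × lookup I j ≡ true
  ∈select⁻ []      []      D z∈ = inj₁ z∈
  ∈select⁻ (x ∷ X) (b ∷ I) D z∈ with ∈select⁻ X I (if b then D ▹ x else D) z∈
  ... | inj₂ (j , z≡ , Ij) = inj₂ (suc j , z≡ , Ij)
  ∈select⁻ (x ∷ X) (false ∷ I) D z∈ | inj₁ z∈D = inj₁ z∈D
  ∈select⁻ (x ∷ X) (true ∷ I)  D z∈ | inj₁ z∈Dx with ∈▹⁻ D z∈Dx
  ... | inj₁ z∈D  = inj₁ z∈D
  ... | inj₂ refl = inj₂ (zero , refl , refl)

  module _ {r} (_≤P_ : Fin r → Fin r → Set) (isPO : IsPartialOrder _≡_ _≤P_)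
           (height : HeightAtMost2 _≤P_) (_≤P?_ : Decidable _≤P_) where

    open IsPartialOrder isPO using (antisym) renaming (refl to ≤P-refl; reflexive to ≤P-reflexive)

    NonMax : Fin r → Set
    NonMax i = ∃ λ j → i ≤P j × i ≢ j

    nonMax? : ∀ i → Dec (NonMax i)
    nonMax? i = Fin.any? (λ j → (i ≤P? j) ×-dec ¬? (i Fin.≟ j))

    -- A non-maximal i goes to a member whose only chosen point is `x i`; a maximal i goes to a
    -- member above `D` whose chosen points are exactly those of the down-set of i. So `x i` lies in
    -- the image of j precisely when i ≤ j, and inclusion of images recovers the order.
    shattered⇒copy : ∀ D (x : Fin r → Fin n) → (∀ i j → x i ≡ x j → i ≡ j) → (∀ i → x i ∉ D) →
      (∀ i → Any (Hit F D (x i)) F) →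
      (∀ (t : Fin r → Bool) → ∃ λ B → B ∈ₗ F × D ⊆ B × (∀ i → lookup B (x i) ≡ t i)) →
      ContainsCopy _≤P_ n F
    shattered⇒copy D x x-inj x∉D hits traces =
      f , (λ i → proj₁ (proj₂ (place i))) , (λ i j eq → antisym (to i j (⊆-reflexive eq)) (to j i (⊆-reflexive (sym eq)))) ,
      λ i j → mk⇔ (from i j) (to i j)
      where
      Placed : Fin r → Subset n → Set
      Placed i S = S ∈ₗ F × x i ∈ S ×
        ((NonMax i × S ⊆ D ▹ x i) ⊎ (¬ NonMax i × D ⊆ S × (∀ j → x j ∈ S → j ≤P i) × (∀ j → j ≤P i → x j ∈ S)))
      place : ∀ i → ∃ (Placed i)
      place i with nonMax? i
      ... | yes nm with find (hits i)
      ...   | A , A∈F , x∈A , A⊆ = A , A∈F , x∈A , inj₁ (nm , A⊆)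
      place i | no ¬nm with traces (λ j → does (j ≤P? i))
      ...   | B , B∈F , D⊆B , Bt = B , B∈F , above i ≤P-refl , inj₂ (¬nm , D⊆B , below , above)
        where
        above : ∀ j → j ≤P i → x j ∈ B
        above j j≤i = lookup⇒∈ (trans (Bt j) (dec-true (j ≤P? i) j≤i))
        below : ∀ j → x j ∈ B → j ≤P i
        below j x∈B with j ≤P? i | trans (sym (∈⇒lookup x∈B)) (Bt j)
        ... | yes j≤i | _  = j≤i
        ... | no _    | ()
      f : Fin r → Subset n
      f i = proj₁ (place i)
      from : ∀ i j → i ≤P j → f i ⊆ f j
      from i j i≤j with i Fin.≟ j
      ... | yes refl = ⊆-refl
      ... | no i≢j with place i | place j
      -- A strict relation i < j with j non-maximal would be a chain of three elements.
      ...   | _ | _ , _ , _ , inj₁ ((l , j≤l , j≢l) , _) = ⊥-elim (height i j l i≤j j≤l i≢j j≢l)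
      ...   | _ , _ , _ , inj₂ (¬nm , _) | _             = ⊥-elim (¬nm (j , i≤j , i≢j))
      ...   | _ , _ , _ , inj₁ (_ , A⊆)  | _ , _ , _ , inj₂ (_ , D⊆B , _ , above) =
              ⊆-trans A⊆ (▹⊆ D⊆B (above i i≤j))
      to : ∀ i j → f i ⊆ f j → i ≤P j
      to i j fi⊆fj with place i | place j
      ... | _ , _ , x∈ , _ | _ , _ , _ , inj₂ (_ , _ , below , _) = below i (fi⊆fj x∈)
      ... | _ , _ , x∈ , _ | _ , _ , _ , inj₁ (_ , A⊆) with ∈▹⁻ D (A⊆ (fi⊆fj x∈))
      ...   | inj₁ x∈D = ⊥-elim (x∉D i x∈D)
      ...   | inj₂ eq  = ≤P-reflexive (x-inj i j eq)

    module _ (noCopy : ¬ ContainsCopy _≤P_ n F) {M} (X : Vec (Fin n) M) (D : Subset n) (R : Vec (Fin n) m)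
             (X! : Distinct X) (X∉D : ∀ {x} → x ∈ᵥ X → x ∉ D) (X∉R : ∀ {x} → x ∈ᵥ X → ¬ (x ∈ᵥ R))
             (hits : ∀ {x} → x ∈ᵥ X → Any (Hit F D x) F)
             {L} (bound : ∀ I → chain (χ F) (select F X I D) R ≤ L) where

      private
        trace : Subset n → Vec Bool M
        trace B = Vec.map (lookup B) X

        above? : ∀ I → Dec (Any (λ B → D ⊆ B × trace B ≡ I) F)
        above? I = any? (λ B → (D ⊆? B) ×-dec Vec.≡-dec Bool._≟_ (trace B) I) F

        b : Vec Bool M → Bool
        b I = does (above? I)

        -- `X` avoids both `D` and `R`, so inside this interval the only points of `X` are those
        -- that `I` put in at the bottom.
        trace-select : ∀ I B → select F X I D ⊆ B → Within B (select F X I D) R → ∀ j → lookup B (lookup X j) ≡ lookup I j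
        trace-select I B ⊆B B⊆ j with lookup I j in Ij
        ... | true = ∈⇒lookup (⊆B (∈select⁺ X I D j Ij))
        ... | false with lookup B (lookup X j) in Bx
        ...   | false = refl
        ...   | true with B⊆ (lookup⇒∈ Bx)
        ...     | inj₂ x∈R = ⊥-elim (X∉R (∈-lookup j X) x∈R)
        ...     | inj₁ x∈S with ∈select⁻ X I D x∈S
        ...       | inj₁ x∈D = ⊥-elim (X∉D (∈-lookup j X) x∈D)
        ...       | inj₂ (j′ , eq , Ij′) with lookup-injective X! j j′ eq
        ...         | refl with trans (sym Ij) Ij′
        ...           | ()

        chain≤b : ∀ I → chain (χ F) (select F X I D) R ≤ (if b I then L else 0ℚ)
        chain≤b I with above? I
        ... | yes _ = bound I
        ... | no ∄B = chain-∅ F (select F X I D) R (λ B B∈F ⊆B B⊆ →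
          ∄B (lose B∈F ((λ z∈D → ⊆B (⊆select X I D z∈D)) ,
            map≡ (lookup B) X I (trace-select I B ⊆B B⊆))))

      0≤L : 0ℚ ≤ L
      0≤L = ≤-trans (chain-nonneg (0≤χ F) _ R) (bound (Vec.replicate M false))

      -- A larger family of traces would shatter r coordinates, and the corresponding good points of
      -- `X` would give a forbidden copy.
      size-b≤ : size b ℕ.≤ chooseSum M r
      size-b≤ with sauer-shelah r b
      ... | inj₁ s≤ = s≤
      ... | inj₂ (θ , θ-inj , sh) = ⊥-elim (noCopy (shattered⇒copy D (λ i → lookup X (θ i))
        (λ i j eq → θ-inj i j (lookup-injective X! (θ i) (θ j) eq))
        (λ i → X∉D (∈-lookup (θ i) X)) (λ i → hits (∈-lookup (θ i) X)) traces))
        where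
        traces : ∀ t → ∃ λ B → B ∈ₗ F × D ⊆ B × (∀ i → lookup B (lookup X (θ i)) ≡ t i)
        traces t with sh t
        ... | I , bI , It with above? I
        ...   | yes B∃ with find B∃
        ...     | B , B∈F , D⊆B , tr = B , B∈F , D⊆B , λ i →
                  trans (sym (Vec.lookup-map (θ i) (lookup B) X)) (trans (cong (λ J → lookup J (θ i)) tr) (It i))

      chain-blend≤ : chain (blend F X) D R ≤ density M r * L
      chain-blend≤ = begin
        chain (blend F X) D R
          ≡⟨ chain-blend F X D R ⟩
        avgᵇ (λ I → chain (χ F) (select F X I D) R)
          ≤⟨ avgᵇ-mono chain≤b ⟩
        a
          ≡⟨ sym (trans (sym (ℚ.*-assoc (inv (2 ℕ.^ M)) (ι (2 ℕ.^ M)) a))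
                        (trans (cong (_* a) (inv*ι (2 ℕ.^ M) (ℕ.m^n>0 2 M))) (ℚ.*-identityˡ a))) ⟩
        inv (2 ℕ.^ M) * (ι (2 ℕ.^ M) * a)
          ≡⟨ cong (_*_ (inv (2 ℕ.^ M))) (avgᵇ-size b L) ⟩
        inv (2 ℕ.^ M) * (L * ι (size b))
          ≤⟨ *-monoˡ-≤ (0≤inv (2 ℕ.^ M)) (*-monoˡ-≤ 0≤L (ι-mono size-b≤)) ⟩
        inv (2 ℕ.^ M) * (L * ι (chooseSum M r))
          ≡⟨ solve 3 (λ p L c → p :* (L :* c) := (c :* p) :* L) refl (inv (2 ℕ.^ M)) L (ι (chooseSum M r)) ⟩
        (ι (chooseSum M r) * inv (2 ℕ.^ M)) * L
          ≡⟨ cong (_* L) (density-def M r) ⟩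
        density M r * L ∎
        where
        open ℚ.≤-Reasoning
        a = avgᵇ (λ I → if b I then L else 0ℚ)

-- The bound for all intervals

-- Bounds the expected number M(m + 1)/(y + 1) of draws from a stopped state with y good elements
-- out of m.
drawCost : ℕ → ℕ → ℚ
drawCost M κ = ι M + ι M * inv κ + 1ℚ

drawCost-def : ∀ M κ → ι M + ι M * inv κ + 1ℚ ≡ drawCost M κ
drawCost-def M κ = refl

module _ {κ b y m : ℕ} (1≤κ : 1 ℕ.≤ κ) (b+y≡m : b ℕ.+ y ≡ m) (stopped : suc κ ℕ.* b ℕ.< m ℕ.+ suc κ) where

  -- The stopping inequality rewritten for the good elements, using b = m - y.
  stopped⇒good : κ ℕ.* m ℕ.+ 1 ℕ.≤ suc κ ℕ.* suc y
  stopped⇒good = ℕ.+-cancelˡ-≤ (suc κ ℕ.* b) _ _ (begin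
    suc κ ℕ.* b ℕ.+ (κ ℕ.* m ℕ.+ 1)   ≡⟨ ℕ-Solver.solve 2 (λ a c → a :+ℕ (c :+ℕ con′ 1) :=ℕ (con′ 1 :+ℕ a) :+ℕ c) refl (suc κ ℕ.* b) (κ ℕ.* m) ⟩
    suc (suc κ ℕ.* b) ℕ.+ κ ℕ.* m     ≤⟨ ℕ.+-monoˡ-≤ (κ ℕ.* m) stopped ⟩
    (m ℕ.+ suc κ) ℕ.+ κ ℕ.* m         ≡⟨ cong (λ t → (t ℕ.+ suc κ) ℕ.+ κ ℕ.* t) (sym b+y≡m) ⟩
    (b ℕ.+ y ℕ.+ suc κ) ℕ.+ κ ℕ.* (b ℕ.+ y)
      ≡⟨ ℕ-Solver.solve 3 (λ c b y → (b :+ℕ y :+ℕ (con′ 1 :+ℕ c)) :+ℕ c :*ℕ (b :+ℕ y)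
                                   :=ℕ (con′ 1 :+ℕ c) :*ℕ b :+ℕ (con′ 1 :+ℕ c) :*ℕ (con′ 1 :+ℕ y)) refl κ b y ⟩
    suc κ ℕ.* b ℕ.+ suc κ ℕ.* suc y       ∎)
    where open ℕ.≤-Reasoning

  half-good : ∀ {M} → M ℕ.+ M ℕ.< m → M ℕ.≤ y
  half-good {M} 2M<m = ℕ.≮⇒≥ λ y<M → ℕ.<⇒≱ 2M<m (m≤ y<M)
    where
    open ℕ.≤-Reasoning
    bound : suc κ ℕ.* suc m ℕ.≤ suc κ ℕ.* (suc y ℕ.+ suc y)
    bound = begin
      suc κ ℕ.* suc m                      ≤⟨ le 1≤κ (ℕ.≤-trans (ℕ.s≤s ℕ.z≤n) 2M<m) ⟩
      (κ ℕ.* m ℕ.+ 1) ℕ.+ (κ ℕ.* m ℕ.+ 1) ≤⟨ ℕ.+-mono-≤ stopped⇒good stopped⇒good ⟩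
      suc κ ℕ.* suc y ℕ.+ suc κ ℕ.* suc y      ≡⟨ sym (ℕ.*-distribˡ-+ (suc κ) (suc y) (suc y)) ⟩
      suc κ ℕ.* (suc y ℕ.+ suc y)          ∎
      where
      le : ∀ {κ m} → 1 ℕ.≤ κ → 1 ℕ.≤ m → suc κ ℕ.* suc m ℕ.≤ (κ ℕ.* m ℕ.+ 1) ℕ.+ (κ ℕ.* m ℕ.+ 1)
      -- The slack is (κ - 1)(m - 1), written here with shifted variables.
      le {suc c} {suc m} _ _ = ℕ.≤-trans (ℕ.m≤m+n _ (c ℕ.* m)) (ℕ.≤-reflexive
        (ℕ-Solver.solve 2 (λ c m → (con′ 2 :+ℕ c) :*ℕ (con′ 2 :+ℕ m) :+ℕ c :*ℕ m
           :=ℕ ((con′ 1 :+ℕ c) :*ℕ (con′ 1 :+ℕ m) :+ℕ con′ 1) :+ℕ ((con′ 1 :+ℕ c) :*ℕ (con′ 1 :+ℕ m) :+ℕ con′ 1)) refl c m))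
    m≤ : suc y ℕ.≤ M → m ℕ.≤ M ℕ.+ M
    m≤ y<M = ℕ.≤-trans (ℕ.n≤1+n m) (ℕ.≤-trans (ℕ.*-cancelˡ-≤ (suc κ) bound) (ℕ.+-mono-≤ y<M y<M))

  -- `draws≤` with denominators cleared. After scaling by κ + 1 and using `stopped⇒good`, the slack
  -- is M + κ²(m - M) + κ.
  draws-ℕ : ∀ {M} → M ℕ.≤ m → κ ℕ.* (M ℕ.* suc m) ℕ.≤ (M ℕ.* suc κ ℕ.+ κ) ℕ.* suc y
  draws-ℕ {M} M≤m = ℕ.*-cancelˡ-≤ (suc κ) (begin
    suc κ ℕ.* (κ ℕ.* (M ℕ.* suc m))
      ≤⟨ ℕ.m≤m+n _ (M ℕ.+ κ ℕ.* κ ℕ.* d ℕ.+ κ) ⟩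
    suc κ ℕ.* (κ ℕ.* (M ℕ.* suc m)) ℕ.+ (M ℕ.+ κ ℕ.* κ ℕ.* d ℕ.+ κ)
      ≡⟨ cong (λ t → suc κ ℕ.* (κ ℕ.* (M ℕ.* suc t)) ℕ.+ (M ℕ.+ κ ℕ.* κ ℕ.* d ℕ.+ κ)) (sym eq) ⟩
    suc κ ℕ.* (κ ℕ.* (M ℕ.* suc (M ℕ.+ d))) ℕ.+ (M ℕ.+ κ ℕ.* κ ℕ.* d ℕ.+ κ)
      ≡⟨ ℕ-Solver.solve 3 (λ M c d →
           (con′ 1 :+ℕ c) :*ℕ (c :*ℕ (M :*ℕ (con′ 1 :+ℕ (M :+ℕ d)))) :+ℕ (M :+ℕ c :*ℕ c :*ℕ d :+ℕ c)
           :=ℕ (M :*ℕ (con′ 1 :+ℕ c) :+ℕ c) :*ℕ (c :*ℕ (M :+ℕ d) :+ℕ con′ 1)) refl M κ d ⟩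
    (M ℕ.* suc κ ℕ.+ κ) ℕ.* (κ ℕ.* (M ℕ.+ d) ℕ.+ 1)
      ≡⟨ cong (λ t → (M ℕ.* suc κ ℕ.+ κ) ℕ.* (κ ℕ.* t ℕ.+ 1)) eq ⟩
    (M ℕ.* suc κ ℕ.+ κ) ℕ.* (κ ℕ.* m ℕ.+ 1)
      ≤⟨ ℕ.*-monoʳ-≤ (M ℕ.* suc κ ℕ.+ κ) stopped⇒good ⟩
    (M ℕ.* suc κ ℕ.+ κ) ℕ.* (suc κ ℕ.* suc y)
      ≡⟨ ℕ-Solver.solve 3 (λ a k y → a :*ℕ (k :*ℕ y) :=ℕ k :*ℕ (a :*ℕ y)) refl (M ℕ.* suc κ ℕ.+ κ) (suc κ) (suc y) ⟩
    suc κ ℕ.* ((M ℕ.* suc κ ℕ.+ κ) ℕ.* suc y) ∎)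
    where
    open ℕ.≤-Reasoning
    d = m ℕ.∸ M
    eq : M ℕ.+ d ≡ m
    eq = ℕ.m+[n∸m]≡n M≤m

  draws≤ : ∀ {M} → M ℕ.≤ m → ι M * ι (suc m) * inv (suc y) ≤ drawCost M κ
  draws≤ {M} M≤m = begin
    ι M * ι (suc m) * w
      ≡⟨ trans (sym (ℚ.*-identityˡ _)) (cong (_* (ι M * ι (suc m) * w)) (sym (inv*ι κ 1≤κ))) ⟩
    (v * ι κ) * (ι M * ι (suc m) * w)
      ≡⟨ solve 5 (λ v c M N w → (v :* c) :* (M :* N :* w) := (v :* w) :* (c :* (M :* N))) refl v (ι κ) (ι M) (ι (suc m)) w ⟩
    (v * w) * (ι κ * (ι M * ι (suc m)))
      ≤⟨ *-monoˡ-≤ (0≤-* (0≤inv κ) (0≤inv (suc y))) cast ⟩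
    (v * w) * ((ι M * (1ℚ + ι κ) + ι κ) * ι (suc y))
      ≡⟨ solve 5 (λ v c M w Y → (v :* w) :* ((M :* (con 1ℚ :+ c) :+ c) :* Y)
                     := (w :* Y) :* (M :* (v :* c) :+ M :* v :+ v :* c)) refl v (ι κ) (ι M) w (ι (suc y)) ⟩
    (w * ι (suc y)) * (ι M * (v * ι κ) + ι M * v + v * ι κ)
      ≡⟨ cong₂ (λ a b → a * (ι M * b + ι M * v + b)) (inv*ι≡1 y) (inv*ι κ 1≤κ) ⟩
    1ℚ * (ι M * 1ℚ + ι M * v + 1ℚ)
      ≡⟨ solve 2 (λ M v → con 1ℚ :* (M :* con 1ℚ :+ M :* v :+ con 1ℚ) := M :+ M :* v :+ con 1ℚ) refl (ι M) v ⟩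
    ι M + ι M * v + 1ℚ
      ≡⟨ drawCost-def M κ ⟩
    drawCost M κ ∎
    where
    open ℚ.≤-Reasoning
    v = inv κ
    w = inv (suc y)
    cast : ι κ * (ι M * ι (suc m)) ≤ (ι M * (1ℚ + ι κ) + ι κ) * ι (suc y)
    cast = subst₂ _≤_
      (trans (ι-* κ (M ℕ.* suc m)) (cong (_*_ (ι κ)) (ι-* M (suc m))))
      (trans (ι-* (M ℕ.* suc κ ℕ.+ κ) (suc y)) (cong (_* ι (suc y)) (trans (ι-+ (M ℕ.* suc κ) κ) (cong (_+ ι κ) (ι-* M (suc κ))))))
      (ι-mono (draws-ℕ M≤m))

fresh-select : ∀ {n i m} (F : List (Subset n)) (X : Vec (Fin n) i) I {D} {R : Vec (Fin n) m} →
  Fresh D R → (∀ {x} → x ∈ᵥ X → ¬ (x ∈ᵥ R)) → Fresh (select F X I D) R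
fresh-select F []      []          fr X∉R = fr
fresh-select F (x ∷ X) (false ∷ I) fr X∉R = fresh-select F X I fr (λ z∈ → X∉R (there z∈))
fresh-select F (x ∷ X) (true ∷ I)  fr X∉R = fresh-select F X I (fresh-▹ fr (X∉R (here refl))) (λ z∈ → X∉R (there z∈))

module _ {n : ℕ} (F : List (Subset n)) {r : ℕ} (_≤P_ : Fin r → Fin r → Set) (isPO : IsPartialOrder _≡_ _≤P_)
         (height : HeightAtMost2 _≤P_) (_≤P?_ : Decidable _≤P_) (noCopy : ¬ ContainsCopy _≤P_ n F)
         {M κ : ℕ} (1≤M : 1 ℕ.≤ M) (1≤κ : 1 ℕ.≤ κ) {L : ℚ} (small : ι (suc (M ℕ.+ M)) + ι (suc κ) ≤ L)
         (large : density M r * L + drawCost M κ + ι (suc κ) ≤ L) where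

  private
    -- Invariant of the drawing phase. Goodness refers to the stopped state `D₀`, so that one fixed
    -- predicate governs all draws; `hit-mono` transfers it to `D` at the end. The length bound
    -- makes the recursion shrink.
    record Drawn {i m} (m₀ : ℕ) (D₀ : Subset n) (X : Vec (Fin n) i) (D : Subset n) (R : Vec (Fin n) m) : Set where
      field
        grown    : D₀ ⊆ D
        distinct : Distinct X
        X∉D      : ∀ {x} → x ∈ᵥ X → x ∉ D
        X∉R      : ∀ {x} → x ∈ᵥ X → ¬ (x ∈ᵥ R)
        good     : ∀ {x} → x ∈ᵥ X → bad F D₀ x ≡ false
        fresh    : Fresh D R
        length≤  : m ℕ.+ i ℕ.≤ m₀

    open Drawn

    all-∈ : ∀ {i} {P : Fin n → Set} (X : Vec (Fin n) i) → (∀ {x} → x ∈ᵥ X → P x) → VAll.All P X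
    all-∈ []      p = []
    all-∈ (x ∷ X) p = p (here refl) ∷ all-∈ X (λ x∈ → p (there x∈))

    drawn-good : ∀ {i m m₀ D₀ x D} {X : Vec (Fin n) i} {r : Vec (Fin n) m} {R} → Pick x r R →
                 not (bad F D₀ x) ≡ true → Drawn m₀ D₀ X D R → Drawn m₀ D₀ (x ∷ X) D r
    drawn-good {i} {m} {X = X} p g d = record
      { grown    = grown d
      ; distinct = all-∈ X (λ { z∈X refl → X∉R d z∈X (pick-∈ p) }) ∷ distinct d
      ; X∉D      = λ { (here refl) → proj₂ (fresh d) (pick-∈ p) ; (there z∈) → X∉D d z∈ }
      ; X∉R      = λ { (here refl) → proj₂ (distinct-pick p (proj₁ (fresh d))) ; (there z∈) z∈r → X∉R d z∈ (∈-pick⁺ p z∈r) }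
      ; good     = λ { (here refl) → Bool.not-injective g ; (there z∈) → good d z∈ }
      ; fresh    = fresh-skip p (fresh d)
      ; length≤  = ℕ.≤-trans (ℕ.≤-reflexive (ℕ.+-suc m i)) (length≤ d)
      }

    drawn-bad : ∀ {i m m₀ D₀ x D} {X : Vec (Fin n) i} {r : Vec (Fin n) m} {R} → Pick x r R →
                Drawn m₀ D₀ X D R → Drawn m₀ D₀ X D r × Drawn m₀ D₀ X (D ▹ x) r
    drawn-bad {x = x} {D} {X} {r} p d = skipped , record
      { grown    = λ z∈ → ⊆▹ D x (grown d z∈)
      ; distinct = distinct d
      ; X∉D      = λ z∈X z∈Dx → Sum.[ X∉D d z∈X , (λ { refl → X∉R d z∈X (pick-∈ p) }) ] (∈▹⁻ D z∈Dx)
      ; X∉R      = X∉R skipped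
      ; good     = good d
      ; fresh    = fresh-pick p (fresh d)
      ; length≤  = length≤ skipped
      }
      where
      skipped : Drawn _ _ X D r
      skipped = record
        { grown = grown d ; distinct = distinct d ; X∉D = X∉D d ; good = good d
        ; X∉R = λ z∈X z∈r → X∉R d z∈X (∈-pick⁺ p z∈r)
        ; fresh = fresh-skip p (fresh d) ; length≤ = ℕ.≤-trans (ℕ.n≤1+n _) (length≤ d) }

  -- Induction on a bound for the number of remaining elements. Hits before stopping cost κ + 1, so
  -- stopped states must stay below L - (κ + 1).
  chain≤L : ∀ bound {m} D (R : Vec (Fin n) m) → m ℕ.< bound → Fresh D R → chain (χ F) D R ≤ L
  chain≤L (suc top) {m₀} D R (ℕ.s≤s m₀≤top) fr = ≤-trans
    (chain≤stopped+k F κ (λ {m} D R → m ℕ.≤ m₀ × Fresh D R)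
      (λ { p (m≤ , fr) → ℕ.≤-trans (ℕ.n≤1+n _) m≤ , fresh-pick p fr }) K stoppedBound D R (ℕ.≤-refl , fr))
    (≤-reflexive (solve 2 (λ L k → L :- k :+ k := L) refl L (ι (suc κ))))
    where
    K = L - ι (suc κ)

    ≤K : ∀ {p} → p + ι (suc κ) ≤ L → p ≤ K
    ≤K {p} le = ≤-by-difference (L - (p + ι (suc κ))) (≤⇒0≤- le) (solve 3 (λ L p k → L :- k := p :+ (L :- (p :+ k))) refl L p (ι (suc κ)))

    stoppedBound : ∀ {m} D (R : Vec (Fin n) m) → m ℕ.≤ m₀ × Fresh D R → Stopped F κ D R → chain (χ F) D R ≤ K
    stoppedBound {m} D R (m≤m₀ , fr) st with m ℕ.≤? M ℕ.+ M
    -- With at most 2M elements left the chain has at most 2M + 1 sets, and `small` suffices; beyond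
    -- that `half-good` guarantees M good elements.
    ... | yes m≤ = ≤-trans (chain≤length (χ≤1 F) D R) (≤-trans (ι-mono (ℕ.s≤s m≤)) (≤K small))
    ... | no m≰ = begin
      chain (χ F) D R
        ≤⟨ chain-draws F g M (Drawn m D) drawn-good drawn-bad (density M r * L) leaf M [] D R refl undrawn
             (half-good {κ} {count (bad F D) R} 1≤κ sum st {M} (ℕ.≰⇒> m≰)) ⟩
      density M r * L + ι M * ι (suc m) * inv (suc (count g R))
        ≤⟨ ℚ.+-monoʳ-≤ (density M r * L) (draws≤ {κ} {count (bad F D) R} 1≤κ sum st (ℕ.≤-trans (ℕ.m≤m+n M M) (ℕ.<⇒≤ (ℕ.≰⇒> m≰)))) ⟩
      density M r * L + drawCost M κ
        ≤⟨ ≤K large ⟩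
      K ∎
      where
      open ℚ.≤-Reasoning
      g : Fin n → Bool
      g x = not (bad F D x)
      sum : count (bad F D) R ℕ.+ count g R ≡ m
      sum = count-not (bad F D) R
      undrawn : Drawn m D [] D R
      undrawn = record
        { grown = λ z∈ → z∈ ; distinct = [] ; X∉D = λ () ; X∉R = λ () ; good = λ () ; fresh = fr
        ; length≤ = ℕ.≤-reflexive (ℕ.+-identityʳ m) }
      leaf : ∀ {i m′} (X : Vec (Fin n) i) D′ (R′ : Vec (Fin n) m′) → i ≡ M → Drawn m D X D′ R′ →
             chain (blend F X) D′ R′ ≤ density M r * L
      leaf {m′ = m′} X D′ R′ refl d = chain-blend≤ F _≤P_ isPO height _≤P?_ noCopy X D′ R′ (distinct d) (X∉D d) (X∉R d)
        (λ {x} x∈X → hit-mono F x (grown d) (good⇒hit F D x (good d x∈X)))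
        (λ I → chain≤L top (select F X I D′) R′ shorter (fresh-select F X I (fresh d) (X∉R d)))
        where
        -- The M ≥ 1 drawn elements have left the list, so the induction hypothesis applies.
        shorter : m′ ℕ.< top
        shorter = ℕ.≤-trans (ℕ.≤-trans (ℕ.≤-reflexive (ℕ.+-comm 1 m′)) (ℕ.+-monoʳ-≤ m′ 1≤M))
                            (ℕ.≤-trans (length≤ d) (ℕ.≤-trans m≤m₀ m₀≤top))

-- Numerical estimates

*-mono-≤ : ∀ {a b c d} → 0ℚ ≤ a → 0ℚ ≤ d → a ≤ b → c ≤ d → a * c ≤ b * d
*-mono-≤ {a} {b} {c} {d} 0≤a 0≤d a≤b c≤d =
  ≤-trans (*-monoˡ-≤ 0≤a c≤d) (ℚ.*-monoʳ-≤-nonNeg d {{ℚ.nonNegative 0≤d}} a≤b)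

square-mono : ∀ {a b} → 0ℚ ≤ a → a ≤ b → a * a ≤ b * b
square-mono 0≤a a≤b = *-mono-≤ 0≤a (≤-trans 0≤a a≤b) a≤b a≤b

square-cancel : ∀ {a b} → 0ℚ ≤ b → a * a ≤ b * b → a ≤ b
square-cancel {a} {b} 0≤b a²≤b² with a ℚ.≤? b
... | yes a≤b = a≤b
... | no a≰b = ⊥-elim (ℚ.<-irrefl refl (ℚ.<-≤-trans (ℚ.≤-<-trans
  (ℚ.*-monoʳ-≤-nonNeg b {{ℚ.nonNegative 0≤b}} (ℚ.<⇒≤ b<a))
  (ℚ.*-monoʳ-<-pos a {{ℚ.positive (ℚ.≤-<-trans 0≤b b<a)}} b<a)) a²≤b²))
  where b<a = ℚ.≰⇒> a≰b

-- The first term of the series for ln 2 is already ½; for N = 0 the upper bound is 1.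
½≤lnTwoUpper : ∀ N → ½ ≤ lnTwoUpper N
½≤lnTwoUpper zero    = ℚ.*≤* (ℤ.+≤+ (ℕ.s≤s ℕ.z≤n))
½≤lnTwoUpper (suc N) = ≤-trans (partial N)
  (≤-by-difference (inv (suc (suc N) ℕ.* 2 ℕ.^ suc N)) (0≤inv (suc (suc N) ℕ.* 2 ℕ.^ suc N)) refl)
  where
  partial : ∀ N → ½ ≤ lnTwoPartial (suc N)
  partial zero    = ≤-refl
  partial (suc N) = ≤-trans (partial N) (≤-by-difference (inv (suc (suc N) ℕ.* 2 ℕ.^ suc (suc N))) (0≤inv (suc (suc N) ℕ.* 2 ℕ.^ suc (suc N))) refl)

≤16r⇒≤Bound : ∀ r q → let x = q - ι (4 ℕ.* r ℕ.+ 6) in x ≤ 0ℚ ⊎ x * x ≤ ι (16 ℕ.* r) → ≤Bound r q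
≤16r⇒≤Bound r q rewrite /1≡ι (4 ℕ.* r ℕ.+ 6) | /1≡ι (32 ℕ.* r) = Sum.map₂ λ x²≤ N → ≤-trans x²≤ (begin
  ι (16 ℕ.* r)                ≡⟨ solve 1 (λ t → t := (con (ι 2) :* t) :* con ½) refl (ι (16 ℕ.* r)) ⟩
  (ι 2 * ι (16 ℕ.* r)) * ½    ≡⟨ cong (_* ½) (trans (sym (ι-* 2 (16 ℕ.* r))) (cong ι (sym (ℕ.*-assoc 2 16 r)))) ⟩
  ι (32 ℕ.* r) * ½            ≤⟨ *-monoˡ-≤ (0≤ι (32 ℕ.* r)) (½≤lnTwoUpper N) ⟩
  ι (32 ℕ.* r) * lnTwoUpper N ∎)
  where open ℚ.≤-Reasoning

-- An integer between √r and 2√r for the successor r. Keep κ until its square falls short; it then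
-- equals the previous value exactly, and κ + 1 is still below the upper limit.
sqrt-between : ∀ r → ∃ λ κ → 1 ℕ.≤ κ × suc r ℕ.≤ κ ℕ.* κ × κ ℕ.* κ ℕ.≤ 4 ℕ.* suc r
sqrt-between zero = 1 , ℕ.≤-refl , ℕ.≤-refl , ℕ.s≤s ℕ.z≤n
sqrt-between (suc r) with sqrt-between r
... | κ@(suc _) , 1≤κ , lo , hi with suc (suc r) ℕ.≤? κ ℕ.* κ
...   | yes lo′ = κ , 1≤κ , lo′ , ℕ.≤-trans hi (ℕ.*-monoʳ-≤ 4 (ℕ.n≤1+n (suc r)))
...   | no lo≰ = suc κ , ℕ.s≤s ℕ.z≤n , subst (suc (suc r) ℕ.≤_) (sym eq) (ℕ.s≤s (ℕ.m≤m+n (suc r) _)) ,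
    subst (ℕ._≤ 4 ℕ.* suc (suc r)) (sym eq) (begin
      suc (suc r ℕ.+ (κ ℕ.+ κ))        ≤⟨ ℕ.s≤s (ℕ.+-monoʳ-≤ (suc r) (ℕ.+-mono-≤ κ≤r κ≤r)) ⟩
      suc (suc r ℕ.+ (suc r ℕ.+ suc r)) ≤⟨ ℕ.m≤m+n _ (suc (suc (suc (suc r)))) ⟩
      suc (suc r ℕ.+ (suc r ℕ.+ suc r)) ℕ.+ suc (suc (suc (suc r)))
        ≡⟨ ℕ-Solver.solve 1 (λ r → con′ 1 :+ℕ ((con′ 1 :+ℕ r) :+ℕ ((con′ 1 :+ℕ r) :+ℕ (con′ 1 :+ℕ r))) :+ℕ (con′ 4 :+ℕ r)
             :=ℕ con′ 4 :*ℕ (con′ 2 :+ℕ r)) refl r ⟩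
      4 ℕ.* suc (suc r) ∎)
  where
  open ℕ.≤-Reasoning
  κ²≡r : κ ℕ.* κ ≡ suc r
  κ²≡r = ℕ.≤-antisym (ℕ.≤-pred (ℕ.≰⇒> lo≰)) lo
  κ≤r : κ ℕ.≤ suc r
  κ≤r = ℕ.≤-trans (ℕ.m≤m*n κ κ) (ℕ.≤-reflexive κ²≡r)
  eq : suc κ ℕ.* suc κ ≡ suc (suc r ℕ.+ (κ ℕ.+ κ))
  eq = trans (ℕ-Solver.solve 1 (λ c → (con′ 1 :+ℕ c) :*ℕ (con′ 1 :+ℕ c) :=ℕ con′ 1 :+ℕ (c :*ℕ c :+ℕ (c :+ℕ c))) refl κ)
             (cong (λ t → suc (t ℕ.+ (κ ℕ.+ κ))) κ²≡r)

module _ (r κ : ℕ) (1≤r : 1 ℕ.≤ r) (1≤κ : 1 ℕ.≤ κ) (r≤κ² : r ℕ.≤ κ ℕ.* κ) (κ²≤4r : κ ℕ.* κ ℕ.≤ 4 ℕ.* r) where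

  private
    R = ι r
    v = inv κ
    -- `c₀` is 1 - 2ρ for the density ρ, and `W` collects the terms of the recursion free of L. The
    -- estimates to come are `z` ≥ √r and `w` ≤ 3√r.
    c₀ = ι (central r) * inv (2 ℕ.^ (r ℕ.+ r))
    W = drawCost (r ℕ.+ r) κ + ι (suc κ)
    z = ι (r ℕ.+ r) * c₀
    w = ι κ + ι (r ℕ.+ r) * v

    invP*P : inv (2 ℕ.^ (r ℕ.+ r)) * ι (2 ℕ.^ (r ℕ.+ r)) ≡ 1ℚ
    invP*P = inv*ι (2 ℕ.^ (r ℕ.+ r)) (ℕ.m^n>0 2 (r ℕ.+ r))

    2ρ+c₀≡1 : ι 2 * density (r ℕ.+ r) r + c₀ ≡ 1ℚ
    2ρ+c₀≡1 = begin
      ι 2 * density (r ℕ.+ r) r + c₀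
        ≡⟨ cong (λ d → ι 2 * d + c₀) (sym (density-def (r ℕ.+ r) r)) ⟩
      ι 2 * (ι (chooseSum (r ℕ.+ r) r) * inv (2 ℕ.^ (r ℕ.+ r))) + ι (central r) * inv (2 ℕ.^ (r ℕ.+ r))
        ≡⟨ solve 4 (λ t a p c → t :* (a :* p) :+ c :* p := p :* (t :* a :+ c)) refl (ι 2) (ι (chooseSum (r ℕ.+ r) r)) (inv (2 ℕ.^ (r ℕ.+ r))) (ι (central r)) ⟩
      inv (2 ℕ.^ (r ℕ.+ r)) * (ι 2 * ι (chooseSum (r ℕ.+ r) r) + ι (central r))
        ≡⟨ cong (_*_ (inv (2 ℕ.^ (r ℕ.+ r)))) (sym (trans (ι-+ (2 ℕ.* chooseSum (r ℕ.+ r) r) (central r)) (cong (_+ ι (central r)) (ι-* 2 (chooseSum (r ℕ.+ r) r))))) ⟩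
      inv (2 ℕ.^ (r ℕ.+ r)) * ι (2 ℕ.* chooseSum (r ℕ.+ r) r ℕ.+ central r)
        ≡⟨ cong (λ t → inv (2 ℕ.^ (r ℕ.+ r)) * ι t) (chooseSum-central r) ⟩
      inv (2 ℕ.^ (r ℕ.+ r)) * ι (2 ℕ.^ (r ℕ.+ r))
        ≡⟨ invP*P ⟩
      1ℚ ∎
      where open ≡-Reasoning

    M≡ : ι (r ℕ.+ r) ≡ R + R
    M≡ = ι-+ r r

    0≤c₀ : 0ℚ ≤ c₀
    0≤c₀ = 0≤-* (0≤ι (central r)) (0≤inv (2 ℕ.^ (r ℕ.+ r)))

    0≤z : 0ℚ ≤ z
    0≤z = 0≤-* (0≤ι (r ℕ.+ r)) 0≤c₀

    -- `4^r≤central` divided by 16^r and multiplied by r.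
    R≤z² : R ≤ z * z
    R≤z² = begin
      R                           ≡⟨ solve 1 (λ R → R := R :* (con 1ℚ :* con 1ℚ)) refl R ⟩
      R * (1ℚ * 1ℚ)               ≡⟨ cong (λ t → R * (t * t)) (sym invP*P) ⟩
      R * ((p * Q) * (p * Q)) ≡⟨ solve 3 (λ R p P → R :* ((p :* P) :* (p :* P)) := (R :* (p :* p)) :* (P :* P)) refl R p Q ⟩
      (R * (p * p)) * (Q * Q)     ≤⟨ *-monoˡ-≤ (0≤-* (0≤ι r) (0≤-* (0≤inv (2 ℕ.^ (r ℕ.+ r))) (0≤inv (2 ℕ.^ (r ℕ.+ r))))) cast ⟩
      (R * (p * p)) * ((ι 4 * R) * (c * c))
        ≡⟨ solve 3 (λ R p c → (R :* (p :* p)) :* ((con (ι 4) :* R) :* (c :* c))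
                           := ((R :+ R) :* (c :* p)) :* ((R :+ R) :* (c :* p))) refl R p c ⟩
      ((R + R) * c₀) * ((R + R) * c₀) ≡⟨ cong (λ t → (t * c₀) * (t * c₀)) (sym M≡) ⟩
      z * z ∎
      where
      open ℚ.≤-Reasoning
      p = inv (2 ℕ.^ (r ℕ.+ r))
      Q = ι (2 ℕ.^ (r ℕ.+ r))
      c = ι (central r)
      cast : ι (2 ℕ.^ (r ℕ.+ r)) * ι (2 ℕ.^ (r ℕ.+ r)) ≤ (ι 4 * R) * (c * c)
      cast = subst₂ _≤_ (ι-* (2 ℕ.^ (r ℕ.+ r)) (2 ℕ.^ (r ℕ.+ r)))
        (trans (ι-* (4 ℕ.* r) (central r ℕ.* central r)) (cong₂ _*_ (ι-* 4 r) (ι-* (central r) (central r))))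
        (ι-mono (4^r≤central r 1≤r))

    κ²lo : R ≤ ι κ * ι κ
    κ²lo = subst (R ≤_) (ι-* κ κ) (ι-mono r≤κ²)

    κ²hi : ι κ * ι κ ≤ ι 4 * R
    κ²hi = subst₂ _≤_ (ι-* κ κ) (ι-* 4 r) (ι-mono κ²≤4r)

    -- (κ² − r)(4r − κ²) ≥ 0 says that κ + 2r/κ ≤ 3√r.
    w²≤9R : w * w ≤ ι 9 * R
    w²≤9R = begin
      w * w
        ≡⟨ cong (λ t → (K + t * v) * (K + t * v)) M≡ ⟩
      (K + (R + R) * v) * (K + (R + R) * v)
        ≡⟨ solve 3 (λ K R v → (K :+ (R :+ R) :* v) :* (K :+ (R :+ R) :* v)
             := (K :* con 1ℚ :+ (R :+ R) :* v) :* (K :* con 1ℚ :+ (R :+ R) :* v)) refl K R v ⟩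
      (K * 1ℚ + (R + R) * v) * (K * 1ℚ + (R + R) * v)
        ≡⟨ cong (λ t → (K * t + (R + R) * v) * (K * t + (R + R) * v)) (sym (inv*ι κ 1≤κ)) ⟩
      (K * (v * K) + (R + R) * v) * (K * (v * K) + (R + R) * v)
        ≤⟨ ≤-by-difference ((v * v) * ((K * K - R) * (ι 4 * R - K * K)))
             (0≤-* (0≤-* (0≤inv κ) (0≤inv κ)) (0≤-* (≤⇒0≤- κ²lo) (≤⇒0≤- κ²hi)))
             (solve 3 (λ K R v → con (ι 9) :* R :* ((v :* K) :* (v :* K))
               := (K :* (v :* K) :+ (R :+ R) :* v) :* (K :* (v :* K) :+ (R :+ R) :* v)
                  :+ (v :* v) :* ((K :* K :- R) :* (con (ι 4) :* R :- K :* K))) refl K R v) ⟩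
      ι 9 * R * ((v * K) * (v * K))
        ≡⟨ cong (λ t → ι 9 * R * (t * t)) (inv*ι κ 1≤κ) ⟩
      ι 9 * R * (1ℚ * 1ℚ)
        ≡⟨ ℚ.*-identityʳ (ι 9 * R) ⟩
      ι 9 * R ∎
      where
      open ℚ.≤-Reasoning
      K = ι κ

  -- The least L meeting `small` and `large` for M = 2r. The second solves L = ρL + W, that is L =
  -- 2W/(1 + c₀).
  limit₁ limit₂ : ℚ
  limit₁ = ι (suc ((r ℕ.+ r) ℕ.+ (r ℕ.+ r))) + ι (suc κ)
  limit₂ = (ι 2 * W) * (ι (2 ℕ.^ (r ℕ.+ r)) * inv ((2 ℕ.^ (r ℕ.+ r)) ℕ.+ central r))

  private
    limit₂-fixpoint : (1ℚ + c₀) * limit₂ ≡ ι 2 * W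
    limit₂-fixpoint = begin
      (1ℚ + c * p) * ((ι 2 * W) * (ι (2 ℕ.^ (r ℕ.+ r)) * i))
        ≡⟨ solve 5 (λ c p W P i → (con 1ℚ :+ c :* p) :* ((con (ι 2) :* W) :* (P :* i))
             := (con (ι 2) :* W) :* (i :* (P :+ c :* (p :* P)))) refl c p W (ι (2 ℕ.^ (r ℕ.+ r))) i ⟩
      (ι 2 * W) * (i * (ι (2 ℕ.^ (r ℕ.+ r)) + c * (p * ι (2 ℕ.^ (r ℕ.+ r)))))
        ≡⟨ cong (λ t → (ι 2 * W) * (i * (ι (2 ℕ.^ (r ℕ.+ r)) + t))) (trans (cong (_*_ c) invP*P) (ℚ.*-identityʳ c)) ⟩
      (ι 2 * W) * (i * (ι (2 ℕ.^ (r ℕ.+ r)) + c))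
        ≡⟨ cong (_*_ (ι 2 * W)) (trans (cong (_*_ i) (sym (ι-+ (2 ℕ.^ (r ℕ.+ r)) (central r)))) i*≡1) ⟩
      (ι 2 * W) * 1ℚ
        ≡⟨ ℚ.*-identityʳ (ι 2 * W) ⟩
      ι 2 * W ∎
      where
      open ≡-Reasoning
      c = ι (central r)
      p = inv (2 ℕ.^ (r ℕ.+ r))
      i = inv ((2 ℕ.^ (r ℕ.+ r)) ℕ.+ central r)
      i*≡1 : i * ι ((2 ℕ.^ (r ℕ.+ r)) ℕ.+ central r) ≡ 1ℚ
      i*≡1 = inv*ι ((2 ℕ.^ (r ℕ.+ r)) ℕ.+ central r) (ℕ.≤-trans (ℕ.m^n>0 2 (r ℕ.+ r)) (ℕ.m≤m+n (2 ℕ.^ (r ℕ.+ r)) (central r)))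

  limit₂≤⇒large : ∀ L → limit₂ ≤ L → density (r ℕ.+ r) r * L + drawCost (r ℕ.+ r) κ + ι (suc κ) ≤ L
  limit₂≤⇒large L le = ≤-by-difference (½ * ((1ℚ + c₀) * (L - limit₂)))
    (0≤-* 0≤½ (0≤-* (0≤-+ 0≤1 0≤c₀) (≤⇒0≤- le)))
    (sym (begin
      density (r ℕ.+ r) r * L + drawCost (r ℕ.+ r) κ + ι (suc κ) + ½ * ((1ℚ + c₀) * (L - limit₂))
        ≡⟨ solve 6 (λ ρ L a k c l → ρ :* L :+ a :+ k :+ con ½ :* ((con 1ℚ :+ c) :* (L :- l))
             := con ½ :* (((con (ι 2) :* ρ :+ c) :+ con 1ℚ) :* L) :+ (a :+ k) :- con ½ :* ((con 1ℚ :+ c) :* l)) refl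
             (density (r ℕ.+ r) r) L (drawCost (r ℕ.+ r) κ) (ι (suc κ)) c₀ limit₂ ⟩
      ½ * (((ι 2 * density (r ℕ.+ r) r + c₀) + 1ℚ) * L) + W - ½ * ((1ℚ + c₀) * limit₂)
        ≡⟨ cong₂ (λ a b → ½ * ((a + 1ℚ) * L) + W - ½ * b) 2ρ+c₀≡1 limit₂-fixpoint ⟩
      ½ * ((1ℚ + 1ℚ) * L) + W - ½ * (ι 2 * W)
        ≡⟨ solve 2 (λ L W → con ½ :* ((con 1ℚ :+ con 1ℚ) :* L) :+ W :- con ½ :* (con (ι 2) :* W) := L) refl L W ⟩
      L ∎))
    where open ≡-Reasoning

  module _ {q : ℚ} (0≤x : 0ℚ ≤ q - ι (4 ℕ.* r ℕ.+ 6)) where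

    private
      x = q - ι (4 ℕ.* r ℕ.+ 6)

      4r+6≡ : ι (4 ℕ.* r ℕ.+ 6) ≡ ι 4 * R + ι 6
      4r+6≡ = trans (ι-+ (4 ℕ.* r) 6) (cong (_+ ι 6) (ι-* 4 r))

      x≡ : x ≡ q - (ι 4 * R + ι 6)
      x≡ = cong (λ t → q - t) 4r+6≡

    ≤limit₁⇒x²≤16r : q ≤ limit₁ → x * x ≤ ι (16 ℕ.* r)
    ≤limit₁⇒x²≤16r q≤ = begin
      x * x         ≤⟨ square-mono 0≤x x≤κ ⟩
      ι κ * ι κ     ≤⟨ κ²hi ⟩
      ι 4 * R       ≤⟨ ≤-by-difference (ι 12 * R) (0≤-* (0≤ι 12) (0≤ι r))
                         (solve 1 (λ R → con (ι 16) :* R := con (ι 4) :* R :+ con (ι 12) :* R) refl R) ⟩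
      ι 16 * R      ≡⟨ sym (ι-* 16 r) ⟩
      ι (16 ℕ.* r)  ∎
      where
      open ℚ.≤-Reasoning
      x≤κ : x ≤ ι κ
      x≤κ = ≤-by-difference ((limit₁ - q) + ι 4) (0≤-+ (≤⇒0≤- q≤) (0≤ι 4)) (sym (Eq.begin
        x + ((limit₁ - q) + ι 4)
          Eq.≡⟨ cong₂ (λ a b → a + ((b - q) + ι 4)) x≡ (cong (_+ ι (suc κ)) (cong (_+_ 1ℚ) (trans (ι-+ (r ℕ.+ r) (r ℕ.+ r)) (cong₂ _+_ M≡ M≡)))) ⟩
        (q - (ι 4 * R + ι 6)) + ((((1ℚ + ((R + R) + (R + R))) + ι (suc κ)) - q) + ι 4)
          Eq.≡⟨ solve 3 (λ q R K → (q :- (con (ι 4) :* R :+ con (ι 6))) :+ ((((con 1ℚ :+ ((R :+ R) :+ (R :+ R))) :+ (con 1ℚ :+ K)) :- q) :+ con (ι 4)) := K)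
                  refl q R (ι κ) ⟩
        ι κ Eq.∎))
        where module Eq = ≡-Reasoning

    -- Multiplying out (1 + c₀)q ≤ 2W gives x + 2z ≤ 2w ≤ 6√r, and z ≥ √r leaves x ≤ 4√r. To avoid
    -- roots, the assumption x² > 16r is used to get xz ≥ 4r, and (x + 2z)² ≤ 36r is expanded.
    ≤limit₂⇒x²≤16r : q ≤ limit₂ → x * x ≤ ι (16 ℕ.* r)
    ≤limit₂⇒x²≤16r q≤ with (x * x) ℚ.≤? ι (16 ℕ.* r)
    ... | yes x²≤ = x²≤
    ... | no x²≰ = begin
      x * x         ≤⟨ ≤-by-difference _ (0≤-+ (≤⇒0≤- sum²≤) (0≤-+ (0≤-* (0≤ι 4) (≤⇒0≤- 4R≤xz)) (0≤-* (0≤ι 4) (≤⇒0≤- R≤z²))))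
                         (solve 3 (λ R x z → con (ι 16) :* R := x :* x :+ ((con (ι 36) :* R :- (x :+ con (ι 2) :* z) :* (x :+ con (ι 2) :* z))
                             :+ (con (ι 4) :* (x :* z :- con (ι 4) :* R) :+ con (ι 4) :* (z :* z :- R)))) refl R x z) ⟩
      ι 16 * R      ≡⟨ sym (ι-* 16 r) ⟩
      ι (16 ℕ.* r)  ∎
      where
      open ℚ.≤-Reasoning
      16R≤x² : ι 16 * R ≤ x * x
      16R≤x² = subst (_≤ x * x) (ι-* 16 r) (ℚ.<⇒≤ (ℚ.≰⇒> x²≰))
      4R≤xz : ι 4 * R ≤ x * z
      4R≤xz = square-cancel (0≤-* 0≤x 0≤z) (begin
        (ι 4 * R) * (ι 4 * R)  ≡⟨ solve 1 (λ R → (con (ι 4) :* R) :* (con (ι 4) :* R) := (con (ι 16) :* R) :* R) refl R ⟩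
        (ι 16 * R) * R         ≤⟨ *-mono-≤ (0≤-* (0≤ι 16) (0≤ι r)) (0≤-* 0≤z 0≤z) 16R≤x² R≤z² ⟩
        (x * x) * (z * z)      ≡⟨ solve 2 (λ x z → (x :* x) :* (z :* z) := (x :* z) :* (x :* z)) refl x z ⟩
        (x * z) * (x * z)      ∎)
      scaled : (1ℚ + c₀) * q ≤ ι 2 * W
      scaled = ≤-trans (*-monoˡ-≤ (0≤-+ 0≤1 0≤c₀) q≤) (≤-reflexive limit₂-fixpoint)
      x+2z≤2w : x + ι 2 * z ≤ ι 2 * w
      -- The discarded terms are the slack in `scaled` together with 2 + c₀(x + 6); the constant 6
      -- of the theorem makes the 2 non-negative.
      x+2z≤2w = ≤-by-difference ((ι 2 * W - (1ℚ + c₀) * q) + (ι 2 + c₀ * (x + ι 6)))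
        (0≤-+ (≤⇒0≤- scaled) (0≤-+ (0≤ι 2) (0≤-* 0≤c₀ (0≤-+ 0≤x (0≤ι 6)))))
        (subst₂ (λ y e → ι 2 * w ≡ (y + ι 2 * z) + ((ι 2 * (e + ι (suc κ)) - (1ℚ + c₀) * q) + (ι 2 + c₀ * (y + ι 6)))) (sym x≡) (drawCost-def (r ℕ.+ r) κ)
          (subst (λ m → ι 2 * (ι κ + m * v) ≡ ((q - (ι 4 * R + ι 6)) + ι 2 * (m * c₀))
                     + ((ι 2 * ((m + m * v + 1ℚ) + ι (suc κ)) - (1ℚ + c₀) * q) + (ι 2 + c₀ * ((q - (ι 4 * R + ι 6)) + ι 6)))) (sym M≡)
            (solve 5 (λ K R v c q → con (ι 2) :* (K :+ (R :+ R) :* v)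
              := ((q :- (con (ι 4) :* R :+ con (ι 6))) :+ con (ι 2) :* ((R :+ R) :* c))
                 :+ ((con (ι 2) :* (((R :+ R) :+ (R :+ R) :* v :+ con 1ℚ) :+ (con 1ℚ :+ K)) :- (con 1ℚ :+ c) :* q)
                     :+ (con (ι 2) :+ c :* ((q :- (con (ι 4) :* R :+ con (ι 6))) :+ con (ι 6))))) refl (ι κ) R v c₀ q)))
      sum²≤ : (x + ι 2 * z) * (x + ι 2 * z) ≤ ι 36 * R
      sum²≤ = begin
        (x + ι 2 * z) * (x + ι 2 * z) ≤⟨ square-mono (0≤-+ 0≤x (0≤-* (0≤ι 2) 0≤z)) x+2z≤2w ⟩
        (ι 2 * w) * (ι 2 * w)         ≡⟨ solve 1 (λ w → (con (ι 2) :* w) :* (con (ι 2) :* w) := con (ι 4) :* (w :* w)) refl w ⟩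
        ι 4 * (w * w)                 ≤⟨ *-monoˡ-≤ (0≤ι 4) w²≤9R ⟩
        ι 4 * (ι 9 * R)               ≡⟨ solve 1 (λ R → con (ι 4) :* (con (ι 9) :* R) := con (ι 36) :* R) refl R ⟩
        ι 36 * R                      ∎

-- The bound for the whole cube

fresh-allFin : ∀ n → Fresh ⊥ (allFin n)
fresh-allFin n = tabulate⁺ (λ eq → eq) , λ _ → ∉⊥

-- Takes L as the maximum of the two limits, which meets both requirements, and treats separately
-- which of them is attained.
lubell-bound : ∀ s (_≤P_ : Fin (suc s) → Fin (suc s) → Set) → IsPartialOrder _≡_ _≤P_ → HeightAtMost2 _≤P_ →
  Decidable _≤P_ → ∀ n (F : List (Subset n)) → Unique F → ¬ ContainsCopy _≤P_ n F →
  let x = lubell n F - ι (4 ℕ.* suc s ℕ.+ 6) in x ≤ 0ℚ ⊎ x * x ≤ ι (16 ℕ.* suc s)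
lubell-bound s _≤P_ isPO height _≤P?_ n F F! noCopy with sqrt-between s | (lubell n F - ι (4 ℕ.* suc s ℕ.+ 6)) ℚ.≤? 0ℚ
... | _ | yes x≤0 = inj₁ x≤0
... | κ , 1≤κ , lo , hi | no x≰0 = inj₂ (cases (ℚ.⊔-sel l₁ l₂))
  where
  1≤r : 1 ℕ.≤ suc s
  1≤r = ℕ.s≤s ℕ.z≤n
  l₁ = limit₁ (suc s) κ 1≤r 1≤κ lo hi
  l₂ = limit₂ (suc s) κ 1≤r 1≤κ lo hi
  0≤x : 0ℚ ≤ lubell n F - ι (4 ℕ.* suc s ℕ.+ 6)
  0≤x = ℚ.<⇒≤ (ℚ.≰⇒> x≰0)
  lubell≤ : lubell n F ≤ l₁ ℚ.⊔ l₂
  lubell≤ = ≤-trans (lubell≤chain n F F!) (chain≤L F _≤P_ isPO height _≤P?_ noCopy {suc s ℕ.+ suc s} (ℕ.s≤s ℕ.z≤n) 1≤κ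
    (ℚ.p≤p⊔q l₁ l₂) (limit₂≤⇒large (suc s) κ 1≤r 1≤κ lo hi (l₁ ℚ.⊔ l₂) (ℚ.p≤q⊔p l₁ l₂))
    (suc n) ⊥ (allFin n) ℕ.≤-refl (fresh-allFin n))
  cases : l₁ ℚ.⊔ l₂ ≡ l₁ ⊎ l₁ ℚ.⊔ l₂ ≡ l₂ →
          (lubell n F - ι (4 ℕ.* suc s ℕ.+ 6)) * (lubell n F - ι (4 ℕ.* suc s ℕ.+ 6)) ≤ ι (16 ℕ.* suc s)
  cases (inj₁ eq) = ≤limit₁⇒x²≤16r (suc s) κ 1≤r 1≤κ lo hi 0≤x (subst (lubell n F ≤_) eq lubell≤)
  cases (inj₂ eq) = ≤limit₂⇒x²≤16r (suc s) κ 1≤r 1≤κ lo hi 0≤x (subst (lubell n F ≤_) eq lubell≤)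

-- Excluded middle holds under double negation, and double negation commutes with finite products.
¬¬-decidable : ∀ {r} (_∼_ : Fin r → Fin r → Set) → ¬ ¬ Decidable _∼_
¬¬-decidable _∼_ = Fin.sequence rawApplicative (λ i → Fin.sequence rawApplicative (λ j → ¬¬-excluded-middle))
  where open RawMonad ¬¬-Monad using (rawApplicative)

theorem3p8 : (r : ℕ) → 1 ℕ.≤ r
    → (_≤P_ : Fin r → Fin r → Set) → IsPartialOrder _≡_ _≤P_
    → HeightAtMost2 _≤P_
    → (n : ℕ) → 1 ℕ.≤ n → (F : List (Subset n)) → Unique F
    → ¬ ContainsCopy _≤P_ n F
    → ≤Bound r (lubell n F)
theorem3p8 (suc s) _ _≤P_ isPO height n _ F F! noCopy = ≤16r⇒≤Bound (suc s) (lubell n F)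
  -- The stable goal is the pair of rational comparisons with 16r, which is decidable; `≤Bound`
  -- itself quantifies over all N.
  (decidable-stable ((_ ℚ.≤? _) ⊎-dec (_ ℚ.≤? _)) λ ¬bound →
    ¬¬-decidable _≤P_ λ _≤P?_ → ¬bound (lubell-bound s _≤P_ isPO height _≤P?_ n F F! noCopy))
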